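{- There is no connected $k$-regular graph on $n$ vertices with adjacency spectrum $\{[k]^1,[-1]^1,[\alpha]^{m},[\beta]^{n-2-m}\}$, where $k,-1,\alpha,\beta$ are pairwise distinct, $\alpha$ and $\beta$ are not integers, and $2\leq m\leq n-4$.
   Context: Graphs are finite, simple and undirected; spectra are adjacency spectra, $[\lambda]^m$ denoting eigenvalue $\lambda$ with multiplicity $m$. -}

module Defs where

open import Level using (Level; _⊔_) renaming (suc to lsuc)
open import Data.Bool using (Bool; true; false; if_then_else_)
open import Data.Nat using (ℕ; zero; suc)
open import Data.Integer using (ℤ; +_; -[1+_])
open import Data.Fin using (Fin; zero; suc; toℕ; punchIn; _≟_)
open import Data.List using (List; []; _∷_; filter; length; map)
open import Data.List using () renaming (foldr to lfoldr)
open import Data.Product using (Σ; ∃; _×_; _,_)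
open import Relation.Binary.PropositionalEquality using (_≡_)
open import Relation.Nullary using (¬_; does)
open import Relation.Nullary.Decidable using (⌊_⌋)
open import Algebra.Bundles using (CommutativeRing)
open import Algebra.Bundles.Raw using (RawRing)

record Graph (n : ℕ) : Set where
  field
    adj       : Fin n → Fin n → Bool
    symmetric : ∀ i j → adj i j ≡ adj j i
    loopless  : ∀ i → adj i i ≡ false
open Graph public

vertices : (n : ℕ) → List (Fin n)
vertices zero    = []
vertices (suc n) = zero ∷ map suc (vertices n)

degree : ∀ {n} → Graph n → Fin n → ℕ
degree G i = length (filter (λ j → Data.Bool._≟_ (adj G i j) true) (vertices _))
  where import Data.Bool

Regular : ∀ {n} → Graph n → ℕ → Set
Regular G k = ∀ i → degree G i ≡ k

data Walk {n} (G : Graph n) : Fin n → Fin n → Set where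
  here : ∀ {i} → Walk G i i
  step : ∀ {i j l} → adj G i j ≡ true → Walk G j l → Walk G i l

Connected : ∀ {n} → Graph n → Set
Connected G = ∀ i j → Walk G i j

module Det {c ℓ} (R : RawRing c ℓ) where
  open RawRing R

  sumFin : ∀ {n} → (Fin n → Carrier) → Carrier
  sumFin {zero}  f = 0#
  sumFin {suc n} f = f zero + sumFin (λ i → f (suc i))

  sign : ℕ → Carrier → Carrier
  sign zero          x = x
  sign (suc zero)    x = - x
  sign (suc (suc k)) x = sign k x

  det : ∀ {n} → (Fin n → Fin n → Carrier) → Carrier
  det {zero}  M = 1#
  det {suc n} M =
    sumFin (λ j → sign (toℕ j) (M zero j * det (λ i j′ → M (suc i) (punchIn j j′))))

-- Polynomials over a commutative ring, as coefficient lists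
-- (lowest degree first); equality is coefficientwise.

module Poly {c ℓ} (R : CommutativeRing c ℓ) where
  open CommutativeRing R

  P : Set c
  P = List Carrier

  coeff : P → ℕ → Carrier
  coeff []      _       = 0#
  coeff (a ∷ p) zero    = a
  coeff (a ∷ p) (suc i) = coeff p i

  _≈P_ : P → P → Set ℓ
  p ≈P q = ∀ i → coeff p i ≈ coeff q i

  _+P_ : P → P → P
  []      +P q       = q
  (a ∷ p) +P []      = a ∷ p
  (a ∷ p) +P (b ∷ q) = (a + b) ∷ (p +P q)

  scale : Carrier → P → P
  scale a p = map (a *_) p

  _*P_ : P → P → P
  []      *P q = []
  (a ∷ p) *P q = scale a q +P (0# ∷ (p *P q))

  -P_ : P → P
  -P p = map -_ p

  constP : Carrier → P
  constP a = a ∷ []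

  X : P
  X = 0# ∷ 1# ∷ []

  _^P_ : P → ℕ → P
  p ^P zero  = constP 1#
  p ^P suc k = p *P (p ^P k)

  X- : Carrier → P
  X- a = X +P constP (- a)

  polyRawRing : RawRing c ℓ
  polyRawRing = record
    { Carrier = P ; _≈_ = _≈P_ ; _+_ = _+P_ ; _*_ = _*P_
    ; -_ = -P_ ; 0# = [] ; 1# = constP 1# }

  open Det polyRawRing public using () renaming (det to detP)

  ℕ→R : ℕ → Carrier
  ℕ→R zero    = 0#
  ℕ→R (suc n) = 1# + ℕ→R n

  ℤ→R : ℤ → Carrier
  ℤ→R (+ n)    = ℕ→R n
  ℤ→R -[1+ n ] = - ℕ→R (suc n)

  charPoly : ∀ {n} → Graph n → P
  charPoly G = detP (λ i j →
    if does (i ≟ j) then X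
    else (if adj G i j then constP (- 1#) else []))

record CharZeroField c ℓ : Set (lsuc (c ⊔ ℓ)) where
  field
    commutativeRing : CommutativeRing c ℓ
  open CommutativeRing commutativeRing public
  open Poly commutativeRing public
  field
    1≉0      : ¬ (1# ≈ 0#)
    inverse  : ∀ x → ¬ (x ≈ 0#) → ∃ λ y → x * y ≈ 1#
    charZero : ∀ n → ¬ (ℕ→R (suc n) ≈ 0#)

-- "G has adjacency spectrum {[k]^1, [-1]^1, [α]^m, [β]^(n-2-m)}" over F:
-- its characteristic polynomial factors as (x-k)(x+1)(x-α)^m (x-β)^(n-2-m).
module _ {c ℓ} (F : CharZeroField c ℓ) where
  open CharZeroField F

  HasSpectrum : ∀ {n} → Graph n → (k : ℕ) → (α : Carrier) → (m : ℕ)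
              → (β : Carrier) → (m′ : ℕ) → Set ℓ
  HasSpectrum G k α m β m′ =
    charPoly G ≈P (X- (ℕ→R k) *P (X- (- 1#) *P ((X- α ^P m) *P (X- β ^P m′))))

  NonInteger : Carrier → Set ℓ
  NonInteger a = ∀ (z : ℤ) → ¬ (a ≈ ℤ→R z)

-- Comparing coefficients in (x - A) adj(x - A) = χ(x) and in χ′ = tr adj(x - A)
-- shows that χ determines all traces tr Aˡ; comparing A with a diagonal matrix,
-- tr Aˡ = kˡ + (-1)ˡ + m αˡ + m′ βˡ, so s_l = m αˡ + m′ βˡ is an integer for every l.
-- The Hankel determinants of this sequence give h = s₀s₂ - s₁² = m m′ (α - β)² ≠ 0, and
-- h, (α + β) h and (α β)ʲ h are integers.  A number all of whose powers have a common
-- denominator is an integer.  Hence m ≠ m′ would make α an integer, and for m = m′ both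
-- σ = α + β and τ = α β are integers.  From tr A = 0 and k ≤ n = 2m + 2, σ is 0, -1 or -2.
-- With tr A² = nk, σ = 0 gives α = ±1 and σ = -2 gives α = -1.  If σ = -1 then k = -2τ, and
-- the integer matrix D = A² + A + τ(I + J), J the all-ones matrix, satisfies
-- Σ (D_ij² - D_ij) = -2τ² < 0, although d² ≥ d for every integer d.
module Submission where

open import Defs
open import Level using (Level)
open import Algebra.Bundles using (CommutativeRing)
import Algebra.Properties.CommutativeMonoid.Sum as MonoidSum
import Algebra.Properties.CommutativeSemiring.Exp as CommutativeSemiringExp
import Algebra.Properties.Ring as RingProperties
import Algebra.Properties.Semiring.Exp as SemiringExp
import Algebra.Properties.Semiring.Sum as SemiringSum
import Algebra.Solver.Ring as RingSolver
open import Algebra.Solver.Ring.AlmostCommutativeRing using (fromCommutativeRing; _-Raw-AlmostCommutative⟶_)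
open import Data.Bool as Bool using (Bool; true; false; if_then_else_)
open import Data.Empty using (⊥)
open import Data.Fin using (Fin; zero; suc; toℕ; punchIn; _≟_)
import Data.Fin.Properties as Fin
open import Data.Fin.Subset using (Subset; inside; outside; ⊤)
open import Data.Integer as ℤ using (ℤ; +_; -[1+_])
import Data.Integer.DivMod as ℤ
import Data.Integer.Properties as ℤ
open import Data.List using (List; []; _∷_; length; filter; map)
import Data.List.Properties as List
open import Data.Maybe using (Maybe; just; nothing)
open import Data.Nat as ℕ using (ℕ; zero; suc)
open import Data.Nat.Induction using (<-rec)
import Data.Nat.Properties as ℕ
open import Data.Nat.Solver using (module +-*-Solver)
open import Data.Product using (∃; _×_; _,_; proj₁; proj₂; uncurry)
import Data.Sign as Sign
open import Data.Sum using (_⊎_; inj₁; inj₂; reduce)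
open import Data.Vec using ([]; _∷_; insertAt)
open import Function using (_∘_)
open import Relation.Binary.PropositionalEquality as ≡ using (_≡_; _≢_)
import Relation.Binary.Reasoning.Setoid as SetoidReasoning
open import Relation.Nullary using (¬_; Dec; does; yes; no; contradiction)
open import Relation.Nullary.Decidable using (dec-true; dec-false)

-- Integers in a commutative ring

-- The field F carries neither an order nor a decidable equality, and no eigenvector is available in
-- it. Spectral arguments are therefore replaced by traces of powers, Galois conjugation of α and β
-- by common denominators, and every inequality is decided in ℕ, after pulling an equation of F back
-- along the injective map from ℕ. Origin of D when σ = -1: over the reals, A² + A + τI = (A - α)(A
-- - β) vanishes on the eigenspaces of α and β, is τ on an eigenvector v for -1, and is k² + k + τ
-- on the all-ones vector. With k = -2τ and n = 2k = -4τ, adding τJ changes the last value to -τ. So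
-- D has rank two, with eigenvalues -τ on the all-ones vector and τ on v. Its entries have mean 1/4
-- and mean square 1/8, which integers cannot have. The proof reaches these two sums through the
-- traces of A up to the fourth power and the row sums of A alone.

module IntegerCoefficients {c ℓ : Level} (R : CommutativeRing c ℓ) where
  open CommutativeRing R hiding (zero)
  open Poly R using (ℕ→R; ℤ→R)
  open RingProperties ring
  open SetoidReasoning setoid

  ℕ→R-+ : ∀ m n → ℕ→R (m ℕ.+ n) ≈ ℕ→R m + ℕ→R n
  ℕ→R-+ zero    n = sym (+-identityˡ _)
  ℕ→R-+ (suc m) n = trans (+-congˡ (ℕ→R-+ m n)) (sym (+-assoc _ _ _))

  ℕ→R-* : ∀ m n → ℕ→R (m ℕ.* n) ≈ ℕ→R m * ℕ→R n
  ℕ→R-* zero    n = sym (zeroˡ _)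
  ℕ→R-* (suc m) n = begin
    ℕ→R (n ℕ.+ m ℕ.* n)          ≈⟨ ℕ→R-+ n (m ℕ.* n) ⟩
    ℕ→R n + ℕ→R (m ℕ.* n)        ≈⟨ +-cong (sym (*-identityˡ _)) (ℕ→R-* m n) ⟩
    1# * ℕ→R n + ℕ→R m * ℕ→R n   ≈⟨ distribʳ _ _ _ ⟨
    (1# + ℕ→R m) * ℕ→R n         ∎

  private
    -- Done by hand because the ring solver is not yet at hand: its coefficient homomorphism is
    -- built from `ℤ→R-+`, hence from this identity.
    cancel-+ˡ : ∀ x y z → (x + y) - (x + z) ≈ y - z
    cancel-+ˡ x y z = begin
      (x + y) - (x + z)       ≈⟨ +-cong (+-comm x y) (-‿cong (+-comm x z)) ⟩
      (y + x) - (z + x)       ≈⟨ +-congˡ (sym (-‿+-comm z x)) ⟩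
      (y + x) + (- z + - x)   ≈⟨ +-congˡ (+-comm _ _) ⟩
      (y + x) + (- x + - z)   ≈⟨ +-assoc _ _ _ ⟩
      y + (x + (- x + - z))   ≈⟨ +-congˡ (+-assoc _ _ _) ⟨
      y + ((x - x) + - z)     ≈⟨ +-congˡ (trans (+-congʳ (-‿inverseʳ x)) (+-identityˡ _)) ⟩
      y - z                   ∎

  ℤ→R-⊖ : ∀ m n → ℤ→R (m ℤ.⊖ n) ≈ ℕ→R m - ℕ→R n
  ℤ→R-⊖ m       zero    = sym (trans (+-congˡ -0#≈0#) (+-identityʳ _))
  ℤ→R-⊖ zero    (suc n) = sym (+-identityˡ _)
  ℤ→R-⊖ (suc m) (suc n) = begin
    ℤ→R (suc m ℤ.⊖ suc n)    ≡⟨ ≡.cong ℤ→R (ℤ.[1+m]⊖[1+n]≡m⊖n m n) ⟩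
    ℤ→R (m ℤ.⊖ n)            ≈⟨ ℤ→R-⊖ m n ⟩
    ℕ→R m - ℕ→R n            ≈⟨ cancel-+ˡ 1# _ _ ⟨
    ℕ→R (suc m) - ℕ→R (suc n) ∎

  ℤ→R-+ : ∀ i j → ℤ→R (i ℤ.+ j) ≈ ℤ→R i + ℤ→R j
  ℤ→R-+ (+ m)    (+ n)    = ℕ→R-+ m n
  ℤ→R-+ (+ m)    -[1+ n ] = ℤ→R-⊖ m (suc n)
  ℤ→R-+ -[1+ m ] (+ n)    = trans (ℤ→R-⊖ n (suc m)) (+-comm _ _)
  ℤ→R-+ -[1+ m ] -[1+ n ] = begin
    - ℕ→R (suc (suc (m ℕ.+ n)))       ≡⟨ ≡.cong (λ k → - ℕ→R (suc k)) (ℕ.+-suc m n) ⟨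
    - ℕ→R (suc m ℕ.+ suc n)           ≈⟨ -‿cong (ℕ→R-+ (suc m) (suc n)) ⟩
    - (ℕ→R (suc m) + ℕ→R (suc n))     ≈⟨ -‿+-comm _ _ ⟨
    - ℕ→R (suc m) + - ℕ→R (suc n)     ∎

  ℤ→R-neg : ∀ i → ℤ→R (ℤ.- i) ≈ - ℤ→R i
  ℤ→R-neg (+ zero)  = sym -0#≈0#
  ℤ→R-neg (+ suc n) = refl
  ℤ→R-neg -[1+ n ]  = sym (-‿involutive _)

  ℤ→R-* : ∀ i j → ℤ→R (i ℤ.* j) ≈ ℤ→R i * ℤ→R j
  ℤ→R-* (+ m) (+ n) = begin
    ℤ→R (Sign.+ ℤ.◃ m ℕ.* n)  ≡⟨ ≡.cong ℤ→R (ℤ.+◃n≡+n (m ℕ.* n)) ⟩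
    ℕ→R (m ℕ.* n)             ≈⟨ ℕ→R-* m n ⟩
    ℕ→R m * ℕ→R n             ∎
  ℤ→R-* (+ m) -[1+ n ] = begin
    ℤ→R (Sign.- ℤ.◃ m ℕ.* suc n)  ≡⟨ ≡.cong ℤ→R (ℤ.-◃n≡-n (m ℕ.* suc n)) ⟩
    ℤ→R (ℤ.- (+ (m ℕ.* suc n)))   ≈⟨ ℤ→R-neg (+ (m ℕ.* suc n)) ⟩
    - ℕ→R (m ℕ.* suc n)           ≈⟨ -‿cong (ℕ→R-* m (suc n)) ⟩
    - (ℕ→R m * ℕ→R (suc n))       ≈⟨ -‿distribʳ-* _ _ ⟩
    ℕ→R m * - ℕ→R (suc n)         ∎
  ℤ→R-* -[1+ m ] (+ n) = begin
    ℤ→R (Sign.- ℤ.◃ suc m ℕ.* n)  ≡⟨ ≡.cong ℤ→R (ℤ.-◃n≡-n (suc m ℕ.* n)) ⟩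
    ℤ→R (ℤ.- (+ (suc m ℕ.* n)))   ≈⟨ ℤ→R-neg (+ (suc m ℕ.* n)) ⟩
    - ℕ→R (suc m ℕ.* n)           ≈⟨ -‿cong (ℕ→R-* (suc m) n) ⟩
    - (ℕ→R (suc m) * ℕ→R n)       ≈⟨ -‿distribˡ-* _ _ ⟩
    - ℕ→R (suc m) * ℕ→R n         ∎
  ℤ→R-* -[1+ m ] -[1+ n ] = begin
    ℤ→R (Sign.+ ℤ.◃ suc m ℕ.* suc n)  ≡⟨ ≡.cong ℤ→R (ℤ.+◃n≡+n (suc m ℕ.* suc n)) ⟩
    ℕ→R (suc m ℕ.* suc n)             ≈⟨ ℕ→R-* (suc m) (suc n) ⟩
    ℕ→R (suc m) * ℕ→R (suc n)         ≈⟨ -‿involutive _ ⟨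
    - - (ℕ→R (suc m) * ℕ→R (suc n))   ≈⟨ -‿cong (-‿distribˡ-* _ _) ⟩
    - (- ℕ→R (suc m) * ℕ→R (suc n))   ≈⟨ -‿distribʳ-* _ _ ⟩
    - ℕ→R (suc m) * - ℕ→R (suc n)     ∎

  private
    -- Unlike ℤ→R, this interpretation sends the literal 1 to 1# on the nose.
    numeral : ℕ → Carrier
    numeral zero          = 0#
    numeral (suc zero)    = 1#
    numeral (suc (suc n)) = 1# + numeral (suc n)

    constant : ℤ → Carrier
    constant (+ n)    = numeral n
    constant -[1+ n ] = - numeral (suc n)

    numeral≈ : ∀ n → numeral n ≈ ℕ→R n
    numeral≈ zero          = refl
    numeral≈ (suc zero)    = sym (+-identityʳ _)
    numeral≈ (suc (suc n)) = +-congˡ (numeral≈ (suc n))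

    constant≈ : ∀ i → constant i ≈ ℤ→R i
    constant≈ (+ n)    = numeral≈ n
    constant≈ -[1+ n ] = -‿cong (numeral≈ (suc n))

    homomorphism : ℤ.+-*-rawRing -Raw-AlmostCommutative⟶ fromCommutativeRing R
    homomorphism = record
      { ⟦_⟧    = constant
      ; +-homo = λ i j → trans (constant≈ (i ℤ.+ j)) (trans (ℤ→R-+ i j) (sym (+-cong (constant≈ i) (constant≈ j))))
      ; *-homo = λ i j → trans (constant≈ (i ℤ.* j)) (trans (ℤ→R-* i j) (sym (*-cong (constant≈ i) (constant≈ j))))
      ; -‿homo = λ i → trans (constant≈ (ℤ.- i)) (trans (ℤ→R-neg i) (sym (-‿cong (constant≈ i))))
      ; 0-homo = refl
      ; 1-homo = refl
      }

    -- Coefficients are compared in ℤ, since equality in R need not be decidable.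
    equalConstants? : ∀ i j → Maybe (constant i ≈ constant j)
    equalConstants? i j with i ℤ.≟ j
    ... | yes i≡j = just (reflexive (≡.cong constant i≡j))
    ... | no  _   = nothing

  open RingSolver ℤ.+-*-rawRing (fromCommutativeRing R) homomorphism equalConstants? public
    using (solve; _:=_; _:+_; _:*_; _:-_; :-_; con)

-- The polynomial ring

module Polynomials {c ℓ : Level} (R : CommutativeRing c ℓ) where
  open CommutativeRing R hiding (zero)
  open Poly R
  open IntegerCoefficients R
  open SetoidReasoning setoid

  coeff-+ : ∀ p q i → coeff (p +P q) i ≈ coeff p i + coeff q i
  coeff-+ []      q       i       = sym (+-identityˡ _)
  coeff-+ (a ∷ p) []      i       = sym (+-identityʳ _)
  coeff-+ (a ∷ p) (b ∷ q) zero    = refl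
  coeff-+ (a ∷ p) (b ∷ q) (suc i) = coeff-+ p q i

  coeff-scale : ∀ a p i → coeff (scale a p) i ≈ a * coeff p i
  coeff-scale a []      i       = sym (zeroʳ a)
  coeff-scale a (b ∷ p) zero    = refl
  coeff-scale a (b ∷ p) (suc i) = coeff-scale a p i

  coeff-neg : ∀ p i → coeff (-P p) i ≈ - coeff p i
  coeff-neg []      i       = solve 0 (con (+ 0) := :- con (+ 0)) refl
  coeff-neg (b ∷ p) zero    = refl
  coeff-neg (b ∷ p) (suc i) = coeff-neg p i

  coeff-*-∷ : ∀ a p q i → coeff ((a ∷ p) *P q) i ≈ a * coeff q i + coeff (0# ∷ (p *P q)) i
  coeff-*-∷ a p q i = trans (coeff-+ (scale a q) _ i) (+-congʳ (coeff-scale a q i))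

  coeff-length : ∀ p i → length p ℕ.≤ i → coeff p i ≈ 0#
  coeff-length []      i       _           = refl
  coeff-length (a ∷ p) (suc i) (ℕ.s≤s p≤i) = coeff-length p i p≤i

  ∷-cong : ∀ a p q → p ≈P q → (a ∷ p) ≈P (a ∷ q)
  ∷-cong a p q p≈q zero    = refl
  ∷-cong a p q p≈q (suc i) = p≈q i

  +P-cong : ∀ {p p′ q q′} → p ≈P p′ → q ≈P q′ → (p +P q) ≈P (p′ +P q′)
  +P-cong {p} {p′} {q} {q′} p≈ q≈ i =
    trans (coeff-+ p q i) (trans (+-cong (p≈ i) (q≈ i)) (sym (coeff-+ p′ q′ i)))

  *P-congˡ : ∀ p {q q′} → q ≈P q′ → (p *P q) ≈P (p *P q′)
  *P-congˡ []      q≈ i = refl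
  *P-congˡ (a ∷ p) {q} {q′} q≈ i = begin
    coeff ((a ∷ p) *P q) i                    ≈⟨ coeff-*-∷ a p q i ⟩
    a * coeff q i + coeff (0# ∷ (p *P q)) i   ≈⟨ +-cong (*-congˡ (q≈ i)) (∷-cong 0# (p *P q) (p *P q′) (*P-congˡ p q≈) i) ⟩
    a * coeff q′ i + coeff (0# ∷ (p *P q′)) i ≈⟨ coeff-*-∷ a p q′ i ⟨
    coeff ((a ∷ p) *P q′) i                   ∎

  *P-zeroʳ : ∀ p → (p *P []) ≈P []
  *P-zeroʳ []      i       = refl
  *P-zeroʳ (a ∷ p) zero    = refl
  *P-zeroʳ (a ∷ p) (suc i) = *P-zeroʳ p i

  -- Mirror image of the defining clause of `_*P_`; with both expansions, commutativity becomes an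
  -- induction on one factor.
  *P-∷ʳ : ∀ p b q → (p *P (b ∷ q)) ≈P (scale b p +P (0# ∷ (p *P q)))
  *P-∷ʳ []      b q zero    = refl
  *P-∷ʳ []      b q (suc i) = refl
  *P-∷ʳ (a ∷ p) b q zero    = +-congʳ (*-comm a b)
  *P-∷ʳ (a ∷ p) b q (suc i) = begin
    coeff (scale a q +P (p *P (b ∷ q))) i
      ≈⟨ coeff-+ (scale a q) _ i ⟩
    coeff (scale a q) i + coeff (p *P (b ∷ q)) i
      ≈⟨ +-cong (coeff-scale a q i) (trans (*P-∷ʳ p b q i) (coeff-+ (scale b p) _ i)) ⟩
    a * coeff q i + (coeff (scale b p) i + coeff (0# ∷ (p *P q)) i)
      ≈⟨ solve 3 (λ x y z → x :+ (y :+ z) := y :+ (x :+ z)) refl _ _ _ ⟩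
    coeff (scale b p) i + (a * coeff q i + coeff (0# ∷ (p *P q)) i)
      ≈⟨ +-congˡ (coeff-*-∷ a p q i) ⟨
    coeff (scale b p) i + coeff ((a ∷ p) *P q) i
      ≈⟨ coeff-+ (scale b p) _ i ⟨
    coeff (scale b p +P ((a ∷ p) *P q)) i ∎

  *P-comm : ∀ p q → (p *P q) ≈P (q *P p)
  *P-comm []      q i = sym (*P-zeroʳ q i)
  *P-comm (a ∷ p) q i = begin
    coeff (scale a q +P (0# ∷ (p *P q))) i
      ≈⟨ +P-cong {scale a q} {scale a q} {0# ∷ (p *P q)} {0# ∷ (q *P p)} (λ _ → refl) (∷-cong 0# (p *P q) (q *P p) (*P-comm p q)) i ⟩
    coeff (scale a q +P (0# ∷ (q *P p))) i  ≈⟨ *P-∷ʳ q a p i ⟨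
    coeff (q *P (a ∷ p)) i                  ∎

  -- An induction on the left factors would have to match lists of different lengths. Commutativity
  -- moves the factor to be replaced to the right, where `*P-congˡ` applies.
  *P-cong : ∀ {p p′ q q′} → p ≈P p′ → q ≈P q′ → (p *P q) ≈P (p′ *P q′)
  *P-cong {p} {p′} {q} {q′} p≈ q≈ i = begin
    coeff (p *P q) i    ≈⟨ *P-congˡ p q≈ i ⟩
    coeff (p *P q′) i   ≈⟨ *P-comm p q′ i ⟩
    coeff (q′ *P p) i   ≈⟨ *P-congˡ q′ p≈ i ⟩
    coeff (q′ *P p′) i  ≈⟨ *P-comm q′ p′ i ⟩
    coeff (p′ *P q′) i  ∎

  *P-distribˡ : ∀ p q r → (p *P (q +P r)) ≈P ((p *P q) +P (p *P r))
  *P-distribˡ []      q r i = refl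
  *P-distribˡ (a ∷ p) q r i = begin
    coeff ((a ∷ p) *P (q +P r)) i
      ≈⟨ coeff-*-∷ a p (q +P r) i ⟩
    a * coeff (q +P r) i + coeff (0# ∷ (p *P (q +P r))) i
      ≈⟨ +-cong (*-congˡ (coeff-+ q r i)) (shifted i) ⟩
    a * (coeff q i + coeff r i) + (coeff (0# ∷ (p *P q)) i + coeff (0# ∷ (p *P r)) i)
      ≈⟨ solve 5 (λ a x y z w → a :* (x :+ y) :+ (z :+ w) := (a :* x :+ z) :+ (a :* y :+ w)) refl _ _ _ _ _ ⟩
    (a * coeff q i + coeff (0# ∷ (p *P q)) i) + (a * coeff r i + coeff (0# ∷ (p *P r)) i)
      ≈⟨ +-cong (coeff-*-∷ a p q i) (coeff-*-∷ a p r i) ⟨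
    coeff ((a ∷ p) *P q) i + coeff ((a ∷ p) *P r) i
      ≈⟨ coeff-+ ((a ∷ p) *P q) _ i ⟨
    coeff (((a ∷ p) *P q) +P ((a ∷ p) *P r)) i ∎
    where
    shifted : ∀ i → coeff (0# ∷ (p *P (q +P r))) i ≈ coeff (0# ∷ (p *P q)) i + coeff (0# ∷ (p *P r)) i
    shifted zero    = sym (+-identityˡ _)
    shifted (suc i) = trans (*P-distribˡ p q r i) (coeff-+ (p *P q) _ i)

  *P-distribʳ : ∀ p q r → ((q +P r) *P p) ≈P ((q *P p) +P (r *P p))
  *P-distribʳ p q r i = begin
    coeff ((q +P r) *P p) i          ≈⟨ *P-comm (q +P r) p i ⟩
    coeff (p *P (q +P r)) i          ≈⟨ *P-distribˡ p q r i ⟩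
    coeff ((p *P q) +P (p *P r)) i   ≈⟨ +P-cong {p *P q} {q *P p} {p *P r} {r *P p} (*P-comm p q) (*P-comm p r) i ⟩
    coeff ((q *P p) +P (r *P p)) i   ∎

  scale-*P : ∀ a p q → (scale a p *P q) ≈P scale a (p *P q)
  scale-*P a []      q i = refl
  scale-*P a (b ∷ p) q i = begin
    coeff ((a * b ∷ scale a p) *P q) i
      ≈⟨ coeff-*-∷ (a * b) (scale a p) q i ⟩
    (a * b) * coeff q i + coeff (0# ∷ (scale a p *P q)) i
      ≈⟨ +-congˡ (shifted i) ⟩
    (a * b) * coeff q i + a * coeff (0# ∷ (p *P q)) i
      ≈⟨ solve 4 (λ a b x y → (a :* b) :* x :+ a :* y := a :* (b :* x :+ y)) refl _ _ _ _ ⟩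
    a * (b * coeff q i + coeff (0# ∷ (p *P q)) i)
      ≈⟨ *-congˡ (coeff-*-∷ b p q i) ⟨
    a * coeff ((b ∷ p) *P q) i
      ≈⟨ coeff-scale a ((b ∷ p) *P q) i ⟨
    coeff (scale a ((b ∷ p) *P q)) i ∎
    where
    shifted : ∀ i → coeff (0# ∷ (scale a p *P q)) i ≈ a * coeff (0# ∷ (p *P q)) i
    shifted zero    = sym (zeroʳ a)
    shifted (suc i) = trans (scale-*P a p q i) (coeff-scale a (p *P q) i)

  0∷-*P : ∀ p q → ((0# ∷ p) *P q) ≈P (0# ∷ (p *P q))
  0∷-*P p q i = trans (coeff-*-∷ 0# p q i) (trans (+-congʳ (zeroˡ _)) (+-identityˡ _))

  *P-assoc : ∀ p q r → ((p *P q) *P r) ≈P (p *P (q *P r))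
  *P-assoc []      q r i = refl
  *P-assoc (a ∷ p) q r i = begin
    coeff ((scale a q +P (0# ∷ (p *P q))) *P r) i
      ≈⟨ *P-distribʳ r (scale a q) (0# ∷ (p *P q)) i ⟩
    coeff ((scale a q *P r) +P ((0# ∷ (p *P q)) *P r)) i
      ≈⟨ coeff-+ (scale a q *P r) _ i ⟩
    coeff (scale a q *P r) i + coeff ((0# ∷ (p *P q)) *P r) i
      ≈⟨ +-cong (scale-*P a q r i) (trans (0∷-*P (p *P q) r i) (∷-cong 0# ((p *P q) *P r) (p *P (q *P r)) (*P-assoc p q r) i)) ⟩
    coeff (scale a (q *P r)) i + coeff (0# ∷ (p *P (q *P r))) i
      ≈⟨ coeff-+ (scale a (q *P r)) _ i ⟨
    coeff ((a ∷ p) *P (q *P r)) i ∎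

  coeff-constP-* : ∀ a p i → coeff (constP a *P p) i ≈ a * coeff p i
  coeff-constP-* a p zero    = trans (coeff-*-∷ a [] p zero) (+-identityʳ _)
  coeff-constP-* a p (suc i) = trans (coeff-*-∷ a [] p (suc i)) (+-identityʳ _)

  coeff-X-* : ∀ p i → coeff (X *P p) i ≈ coeff (0# ∷ p) i
  coeff-X-* p i = trans (0∷-*P (constP 1#) p i)
    (∷-cong 0# (constP 1# *P p) p (λ j → trans (coeff-constP-* 1# p j) (*-identityˡ _)) i)

  polyRing : CommutativeRing c ℓ
  polyRing = record
    { Carrier = P ; _≈_ = _≈P_ ; _+_ = _+P_ ; _*_ = _*P_ ; -_ = -P_ ; 0# = [] ; 1# = constP 1#
    ; isCommutativeRing = record
      { isRing = record
        { +-isAbelianGroup = record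
          { isGroup = record
            { isMonoid = record
              { isSemigroup = record
                { isMagma = record
                  { isEquivalence = record
                    { refl  = λ i → refl
                    ; sym   = λ p≈q i → sym (p≈q i)
                    ; trans = λ p≈q q≈r i → trans (p≈q i) (q≈r i)
                    }
                  ; ∙-cong = λ {p} {p′} {q} {q′} → +P-cong {p} {p′} {q} {q′}
                  }
                ; assoc = λ p q r i → begin
                    coeff ((p +P q) +P r) i                 ≈⟨ coeff-+ (p +P q) r i ⟩
                    coeff (p +P q) i + coeff r i            ≈⟨ +-congʳ (coeff-+ p q i) ⟩
                    (coeff p i + coeff q i) + coeff r i     ≈⟨ +-assoc _ _ _ ⟩
                    coeff p i + (coeff q i + coeff r i)     ≈⟨ +-congˡ (coeff-+ q r i) ⟨
                    coeff p i + coeff (q +P r) i            ≈⟨ coeff-+ p (q +P r) i ⟨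
                    coeff (p +P (q +P r)) i                 ∎
                }
              ; identity = (λ p i → refl) , (λ p i → trans (coeff-+ p [] i) (+-identityʳ _))
              }
            ; inverse = (λ p i → trans (coeff-+ (-P p) p i) (trans (+-congʳ (coeff-neg p i)) (-‿inverseˡ _)))
                      , (λ p i → trans (coeff-+ p (-P p) i) (trans (+-congˡ (coeff-neg p i)) (-‿inverseʳ _)))
            ; ⁻¹-cong = λ {p} {q} p≈q i → trans (coeff-neg p i) (trans (-‿cong (p≈q i)) (sym (coeff-neg q i)))
            }
          ; comm = λ p q i → trans (coeff-+ p q i) (trans (+-comm _ _) (sym (coeff-+ q p i)))
          }
        ; *-cong = λ {p} {p′} {q} {q′} → *P-cong {p} {p′} {q} {q′}
        ; *-assoc = *P-assoc
        ; *-identity = (λ p i → trans (coeff-constP-* 1# p i) (*-identityˡ _))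
                     , (λ p i → trans (*P-comm p (constP 1#) i) (trans (coeff-constP-* 1# p i) (*-identityˡ _)))
        ; distrib = *P-distribˡ , *P-distribʳ
        }
      ; *-comm = *P-comm
      }
    }

  -- The product rule for a + x p. The recursion carries no exponent; the factor i + 1 reappears in
  -- `coeff-deriv`.
  deriv : P → P
  deriv []      = []
  deriv (a ∷ p) = p +P (0# ∷ deriv p)

  coeff-deriv : ∀ p i → coeff (deriv p) i ≈ ℕ→R (suc i) * coeff p (suc i)
  coeff-deriv []      i       = sym (zeroʳ _)
  coeff-deriv (a ∷ p) zero    =
    trans (coeff-+ p _ 0) (solve 1 (λ x → x :+ con (+ 0) := (con (+ 1) :+ con (+ 0)) :* x) refl _)
  coeff-deriv (a ∷ p) (suc i) = begin
    coeff (p +P (0# ∷ deriv p)) (suc i)                   ≈⟨ coeff-+ p _ (suc i) ⟩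
    coeff p (suc i) + coeff (deriv p) i                   ≈⟨ +-congˡ (coeff-deriv p i) ⟩
    coeff p (suc i) + ℕ→R (suc i) * coeff p (suc i)       ≈⟨ solve 2 (λ x y → x :+ y :* x := (con (+ 1) :+ y) :* x) refl _ _ ⟩
    ℕ→R (suc (suc i)) * coeff p (suc i)                   ∎

  deriv-cong : ∀ {p q} → p ≈P q → deriv p ≈P deriv q
  deriv-cong {p} {q} p≈q i = trans (coeff-deriv p i) (trans (*-congˡ (p≈q (suc i))) (sym (coeff-deriv q i)))

  deriv-+ : ∀ p q → deriv (p +P q) ≈P (deriv p +P deriv q)
  deriv-+ p q i = begin
    coeff (deriv (p +P q)) i                                               ≈⟨ coeff-deriv (p +P q) i ⟩
    ℕ→R (suc i) * coeff (p +P q) (suc i)                                   ≈⟨ *-congˡ (coeff-+ p q (suc i)) ⟩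
    ℕ→R (suc i) * (coeff p (suc i) + coeff q (suc i))                      ≈⟨ distribˡ _ _ _ ⟩
    ℕ→R (suc i) * coeff p (suc i) + ℕ→R (suc i) * coeff q (suc i)          ≈⟨ +-cong (coeff-deriv p i) (coeff-deriv q i) ⟨
    coeff (deriv p) i + coeff (deriv q) i                                  ≈⟨ coeff-+ (deriv p) _ i ⟨
    coeff (deriv p +P deriv q) i                                           ∎

  deriv-* : ∀ p q → deriv (p *P q) ≈P ((deriv p *P q) +P (p *P deriv q))
  deriv-* []      q i = refl
  deriv-* (a ∷ p) q i = begin
    coeff (deriv ((a ∷ p) *P q)) i
      ≈⟨ coeff-deriv ((a ∷ p) *P q) i ⟩
    ℕ→R (suc i) * coeff ((a ∷ p) *P q) (suc i)
      ≈⟨ *-congˡ (coeff-*-∷ a p q (suc i)) ⟩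
    ℕ→R (suc i) * (a * coeff q (suc i) + coeff (p *P q) i)
      ≈⟨ solve 4 (λ n a x y → n :* (a :* x :+ y) := n :* y :+ a :* (n :* x)) refl _ _ _ _ ⟩
    ℕ→R (suc i) * coeff (p *P q) i + a * (ℕ→R (suc i) * coeff q (suc i))
      ≈⟨ +-cong (euler i) (*-congˡ (sym (coeff-deriv q i))) ⟩
    (coeff (p *P q) i + (coeff (0# ∷ (deriv p *P q)) i + coeff (0# ∷ (p *P deriv q)) i)) + a * coeff (deriv q) i
      ≈⟨ solve 4 (λ x y z w → (x :+ (y :+ z)) :+ w := (x :+ y) :+ (w :+ z)) refl _ _ _ _ ⟩
    (coeff (p *P q) i + coeff (0# ∷ (deriv p *P q)) i) + (a * coeff (deriv q) i + coeff (0# ∷ (p *P deriv q)) i)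
      ≈⟨ +-cong (+-congˡ (0∷-*P (deriv p) q i)) (coeff-*-∷ a p (deriv q) i) ⟨
    (coeff (p *P q) i + coeff ((0# ∷ deriv p) *P q) i) + coeff ((a ∷ p) *P deriv q) i
      ≈⟨ +-congʳ (trans (*P-distribʳ q p (0# ∷ deriv p) i) (coeff-+ (p *P q) _ i)) ⟨
    coeff ((p +P (0# ∷ deriv p)) *P q) i + coeff ((a ∷ p) *P deriv q) i
      ≈⟨ coeff-+ (deriv (a ∷ p) *P q) _ i ⟨
    coeff ((deriv (a ∷ p) *P q) +P ((a ∷ p) *P deriv q)) i ∎
    where
    -- Both sides are the i-th coefficient of (x p q)′ = p q + x (p′ q + p q′). At i + 1 the product
    -- rule is used for the shorter list p.
    euler : ∀ i → ℕ→R (suc i) * coeff (p *P q) i ≈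
                  coeff (p *P q) i + (coeff (0# ∷ (deriv p *P q)) i + coeff (0# ∷ (p *P deriv q)) i)
    euler zero    = solve 1 (λ x → (con (+ 1) :+ con (+ 0)) :* x := x :+ (con (+ 0) :+ con (+ 0))) refl _
    euler (suc i) = begin
      ℕ→R (suc (suc i)) * coeff (p *P q) (suc i)
        ≈⟨ solve 2 (λ n x → (con (+ 1) :+ n) :* x := x :+ n :* x) refl _ _ ⟩
      coeff (p *P q) (suc i) + ℕ→R (suc i) * coeff (p *P q) (suc i)
        ≈⟨ +-congˡ (coeff-deriv (p *P q) i) ⟨
      coeff (p *P q) (suc i) + coeff (deriv (p *P q)) i
        ≈⟨ +-congˡ (trans (deriv-* p q i) (coeff-+ (deriv p *P q) _ i)) ⟩
      coeff (p *P q) (suc i) + (coeff (deriv p *P q) i + coeff (p *P deriv q) i) ∎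

-- Determinants via the exterior algebra

module Exterior {c ℓ : Level} (R : CommutativeRing c ℓ) where
  open CommutativeRing R hiding (zero)
  open IntegerCoefficients R
  open Det rawRing
  open RingProperties ring
  open SemiringSum semiring
  open SetoidReasoning setoid

  δ : ∀ {n} → Fin n → Fin n → Carrier
  δ i j = if does (i ≟ j) then 1# else 0#

  LinearFunctional : ∀ {n} → ((Fin n → Carrier) → Carrier) → Set _
  LinearFunctional f = ∀ a b u v → f (λ i → a * u i + b * v i) ≈ a * f u + b * f v

  Extensional : ∀ {n} → ((Fin n → Carrier) → Carrier) → Set _
  Extensional f = ∀ {u v} → (∀ i → u i ≈ v i) → f u ≈ f v

  private
    extend : ∀ {n} → (Fin n → Carrier) → Fin (suc n) → Carrier
    extend v zero    = 0#
    extend v (suc i) = v i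

  -- Coordinates are split off one at a time: v is v₀ times the first unit vector plus a vector with
  -- first coordinate 0, and on the latter f restricts to a linear functional in one dimension less.
  expand : ∀ {n} (f : (Fin n → Carrier) → Carrier) → Extensional f → LinearFunctional f →
           ∀ v → f v ≈ sum (λ j → v j * f (δ j))
  expand {zero} f f-cong f-linear v = begin
    f v                               ≈⟨ f-cong (λ ()) ⟩
    f (λ i → 0# * v i + 0# * v i)     ≈⟨ f-linear 0# 0# v v ⟩
    0# * f v + 0# * f v               ≈⟨ solve 1 (λ x → con (+ 0) :* x :+ con (+ 0) :* x := con (+ 0)) refl _ ⟩
    0#                                ∎
  expand {suc n} f f-cong f-linear v = begin
    f v
      ≈⟨ f-cong split ⟩
    f (λ i → v zero * δ zero i + 1# * extend (v ∘ suc) i)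
      ≈⟨ f-linear (v zero) 1# (δ zero) (extend (v ∘ suc)) ⟩
    v zero * f (δ zero) + 1# * f (extend (v ∘ suc))
      ≈⟨ +-congˡ (trans (*-identityˡ _) (expand (f ∘ extend) (λ u≈v → f-cong (extend-cong u≈v)) extend-linear (v ∘ suc))) ⟩
    v zero * f (δ zero) + sum (λ j → v (suc j) * f (extend (δ j)))
      ≈⟨ +-congˡ (sum-cong-≋ (λ j → *-congˡ (f-cong (extend-δ j)))) ⟩
    v zero * f (δ zero) + sum (λ j → v (suc j) * f (δ (suc j))) ∎
    where
    split : ∀ i → v i ≈ v zero * δ zero i + 1# * extend (v ∘ suc) i
    split zero    = solve 1 (λ x → x := x :* con (+ 1) :+ con (+ 1) :* con (+ 0)) refl _
    split (suc i) = solve 2 (λ x y → x := y :* con (+ 0) :+ con (+ 1) :* x) refl _ _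

    extend-cong : ∀ {n} {u v : Fin n → Carrier} → (∀ i → u i ≈ v i) → ∀ i → extend u i ≈ extend v i
    extend-cong u≈v zero    = refl
    extend-cong u≈v (suc i) = u≈v i

    extend-linear : LinearFunctional (f ∘ extend)
    extend-linear a b u v = trans (f-cong pointwise) (f-linear a b (extend u) (extend v))
      where
      pointwise : ∀ i → extend (λ i → a * u i + b * v i) i ≈ a * extend u i + b * extend v i
      pointwise zero    = solve 2 (λ a b → con (+ 0) := a :* con (+ 0) :+ b :* con (+ 0)) refl _ _
      pointwise (suc i) = refl

    extend-δ : ∀ {n} (j : Fin n) i → extend (δ j) i ≈ δ (suc j) i
    extend-δ j zero    = refl
    extend-δ j (suc i) = refl

  -- An element of the exterior algebra of Rⁿ is given by its coordinates in the
  -- basis of products e_s (s a subset of the n indices, in increasing order).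
  wedge : ∀ {n} → (Fin n → Carrier) → (Subset n → Carrier) → Subset n → Carrier
  wedge v w []            = 0#
  wedge v w (outside ∷ s) = wedge (v ∘ suc) (w ∘ (outside ∷_)) s
  wedge v w (inside ∷ s)  = v zero * w (outside ∷ s) - wedge (v ∘ suc) (w ∘ (inside ∷_)) s

  wedge-cong : ∀ {n} {u v : Fin n → Carrier} {w x : Subset n → Carrier} →
               (∀ i → u i ≈ v i) → (∀ s → w s ≈ x s) → ∀ s → wedge u w s ≈ wedge v x s
  wedge-cong u≈v w≈x []            = refl
  wedge-cong u≈v w≈x (outside ∷ s) = wedge-cong (u≈v ∘ suc) (w≈x ∘ (outside ∷_)) s
  wedge-cong u≈v w≈x (inside ∷ s)  =
    +-cong (*-cong (u≈v zero) (w≈x _)) (-‿cong (wedge-cong (u≈v ∘ suc) (w≈x ∘ (inside ∷_)) s))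

  wedge-linearˡ : ∀ {n} a b (u v : Fin n → Carrier) w s →
                  wedge (λ i → a * u i + b * v i) w s ≈ a * wedge u w s + b * wedge v w s
  wedge-linearˡ a b u v w [] =
    solve 2 (λ a b → con (+ 0) := a :* con (+ 0) :+ b :* con (+ 0)) refl _ _
  wedge-linearˡ a b u v w (outside ∷ s) = wedge-linearˡ a b (u ∘ suc) (v ∘ suc) (w ∘ (outside ∷_)) s
  wedge-linearˡ a b u v w (inside ∷ s)  =
    trans (+-congˡ (-‿cong (wedge-linearˡ a b (u ∘ suc) (v ∘ suc) (w ∘ (inside ∷_)) s)))
      (solve 7 (λ a b u v w x y → (a :* u :+ b :* v) :* w :- (a :* x :+ b :* y) :=
                                  a :* (u :* w :- x) :+ b :* (v :* w :- y)) refl _ _ _ _ _ _ _)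

  wedge-linearʳ : ∀ {n} a b (v : Fin n → Carrier) w x s →
                  wedge v (λ t → a * w t + b * x t) s ≈ a * wedge v w s + b * wedge v x s
  wedge-linearʳ a b v w x [] =
    solve 2 (λ a b → con (+ 0) := a :* con (+ 0) :+ b :* con (+ 0)) refl _ _
  wedge-linearʳ a b v w x (outside ∷ s) = wedge-linearʳ a b (v ∘ suc) (w ∘ (outside ∷_)) (x ∘ (outside ∷_)) s
  wedge-linearʳ a b v w x (inside ∷ s)  =
    trans (+-congˡ (-‿cong (wedge-linearʳ a b (v ∘ suc) (w ∘ (inside ∷_)) (x ∘ (inside ∷_)) s)))
      (solve 7 (λ a b v w x y z → v :* (a :* w :+ b :* x) :- (a :* y :+ b :* z) :=
                                  a :* (v :* w :- y) :+ b :* (v :* x :- z)) refl _ _ _ _ _ _ _)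

  wedge-+ʳ : ∀ {n} (v : Fin n → Carrier) w x s →
             wedge v (λ t → w t + x t) s ≈ wedge v w s + wedge v x s
  wedge-+ʳ v w x s = begin
    wedge v (λ t → w t + x t) s               ≈⟨ wedge-cong (λ _ → refl) (λ t → +-cong (*-identityˡ _) (*-identityˡ _)) s ⟨
    wedge v (λ t → 1# * w t + 1# * x t) s     ≈⟨ wedge-linearʳ 1# 1# v w x s ⟩
    1# * wedge v w s + 1# * wedge v x s       ≈⟨ +-cong (*-identityˡ _) (*-identityˡ _) ⟩
    wedge v w s + wedge v x s                 ∎

  wedge-*-‿ʳ : ∀ {n} a (v : Fin n → Carrier) w x s →
               wedge v (λ t → a * w t - x t) s ≈ a * wedge v w s - wedge v x s
  wedge-*-‿ʳ a v w x s = begin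
    wedge v (λ t → a * w t - x t) s               ≈⟨ wedge-cong (λ _ → refl) (λ t → +-congˡ (-1*x≈-x _)) s ⟨
    wedge v (λ t → a * w t + - 1# * x t) s        ≈⟨ wedge-linearʳ a (- 1#) v w x s ⟩
    a * wedge v w s + - 1# * wedge v x s          ≈⟨ +-congˡ (-1*x≈-x _) ⟩
    a * wedge v w s - wedge v x s                 ∎

  wedge-zeroʳ : ∀ {n} (v : Fin n → Carrier) {w} → (∀ s → w s ≈ 0#) → ∀ s → wedge v w s ≈ 0#
  wedge-zeroʳ v w≈0 []            = refl
  wedge-zeroʳ v w≈0 (outside ∷ s) = wedge-zeroʳ (v ∘ suc) (w≈0 ∘ (outside ∷_)) s
  wedge-zeroʳ v w≈0 (inside ∷ s)  =
    trans (+-cong (*-congˡ (w≈0 _)) (-‿cong (wedge-zeroʳ (v ∘ suc) (w≈0 ∘ (inside ∷_)) s)))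
      (solve 1 (λ x → x :* con (+ 0) :- con (+ 0) := con (+ 0)) refl _)

  wedge-sumʳ : ∀ {n p} (v : Fin n → Carrier) (w : Fin p → Subset n → Carrier) s →
               wedge v (λ t → sum (λ i → w i t)) s ≈ sum (λ i → wedge v (w i) s)
  wedge-sumʳ {p = zero}  v w s = wedge-zeroʳ v (λ _ → refl) s
  wedge-sumʳ {p = suc p} v w s = trans (wedge-+ʳ v (w zero) _ s) (+-congˡ (wedge-sumʳ v (w ∘ suc) s))

  -- Write v = v₀ e₀ + v′ and w = w₀ + e₀ ∧ w₁. In the part with e₀ the two terms v₀ (v′ ∧ w₀)
  -- cancel, and v′ ∧ v′ ∧ w₁ vanishes by induction. Anticommutativity alone would give only twice
  -- this statement, and 2 may be a zero divisor.
  wedge-square : ∀ {n} (v : Fin n → Carrier) w s → wedge v (wedge v w) s ≈ 0#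
  wedge-square v w []            = refl
  wedge-square v w (outside ∷ s) = wedge-square (v ∘ suc) _ s
  wedge-square v w (inside ∷ s)  = begin
    v zero * x - wedge v′ (λ t → v zero * w (outside ∷ t) - wedge v′ (w ∘ (inside ∷_)) t) s
      ≈⟨ +-congˡ (-‿cong (trans (wedge-*-‿ʳ (v zero) v′ _ _ s) (+-congˡ (-‿cong (wedge-square v′ _ s))))) ⟩
    v zero * x - (v zero * x - 0#)
      ≈⟨ solve 1 (λ x → x :- (x :- con (+ 0)) := con (+ 0)) refl _ ⟩
    0# ∎
    where
    v′ = v ∘ suc
    x  = wedge v′ (w ∘ (outside ∷_)) s

  wedge-swap : ∀ {n} (u v : Fin n → Carrier) w s → wedge u (wedge v w) s ≈ - wedge v (wedge u w) s
  wedge-swap u v w []            = sym -0#≈0#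
  wedge-swap u v w (outside ∷ s) = wedge-swap (u ∘ suc) (v ∘ suc) _ s
  wedge-swap u v w (inside ∷ s)  = begin
    u zero * y - wedge (u ∘ suc) (λ t → v zero * w (outside ∷ t) - wedge (v ∘ suc) (w ∘ (inside ∷_)) t) s
      ≈⟨ +-congˡ (-‿cong (trans (wedge-*-‿ʳ (v zero) (u ∘ suc) _ _ s) (+-congˡ (-‿cong (wedge-swap (u ∘ suc) (v ∘ suc) _ s))))) ⟩
    u zero * y - (v zero * x - - z)
      ≈⟨ solve 5 (λ u v x y z → u :* y :- (v :* x :- :- z) := :- (v :* x :- (u :* y :- z))) refl _ _ _ _ _ ⟩
    - (v zero * x - (u zero * y - z))
      ≈⟨ -‿cong (+-congˡ (-‿cong (wedge-*-‿ʳ (u zero) (v ∘ suc) _ _ s))) ⟨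
    - (v zero * x - wedge (v ∘ suc) (λ t → u zero * w (outside ∷ t) - wedge (u ∘ suc) (w ∘ (inside ∷_)) t) s) ∎
    where
    x = wedge (u ∘ suc) (w ∘ (outside ∷_)) s
    y = wedge (v ∘ suc) (w ∘ (outside ∷_)) s
    z = wedge (v ∘ suc) (wedge (u ∘ suc) (w ∘ (inside ∷_))) s

  one : ∀ {n} → Subset n → Carrier
  one []            = 1#
  one (outside ∷ s) = one s
  one (inside ∷ s)  = 0#

  wedges : ∀ {p n} → (Fin p → Fin n → Carrier) → Subset n → Carrier
  wedges {zero}  M = one
  wedges {suc p} M = wedge (M zero) (wedges (M ∘ suc))

  wedges-cong : ∀ {p n} {M N : Fin p → Fin n → Carrier} → (∀ i j → M i j ≈ N i j) →
                ∀ s → wedges M s ≈ wedges N s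
  wedges-cong {zero}  M≈N s = refl
  wedges-cong {suc p} M≈N s = wedge-cong (M≈N zero) (wedges-cong (M≈N ∘ suc)) s

  -- Setting the j-th basis vector to 0 is a homomorphism of exterior algebras.
  wedge-punch : ∀ {n} (v : Fin (suc n) → Carrier) w (j : Fin (suc n)) s →
                wedge v w (insertAt s j outside) ≈ wedge (v ∘ punchIn j) (λ t → w (insertAt t j outside)) s
  wedge-punch v w zero    s             = refl
  wedge-punch v w (suc j) (outside ∷ s) = wedge-punch (v ∘ suc) (w ∘ (outside ∷_)) j s
  wedge-punch v w (suc j) (inside ∷ s)  = +-congˡ (-‿cong (wedge-punch (v ∘ suc) (w ∘ (inside ∷_)) j s))

  one-punch : ∀ {n} (j : Fin (suc n)) (s : Subset n) → one (insertAt s j outside) ≈ one s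
  one-punch zero    s             = refl
  one-punch (suc j) (outside ∷ s) = one-punch j s
  one-punch (suc j) (inside ∷ s)  = refl

  wedges-punch : ∀ {p n} (M : Fin p → Fin (suc n) → Carrier) j s →
                 wedges M (insertAt s j outside) ≈ wedges (λ i → M i ∘ punchIn j) s
  wedges-punch {zero}  M j s = one-punch j s
  wedges-punch {suc p} M j s =
    trans (wedge-punch (M zero) _ j s) (wedge-cong (λ _ → refl) (wedges-punch (M ∘ suc) j) s)

  sign-cong : ∀ k {x y} → x ≈ y → sign k x ≈ sign k y
  sign-cong zero          x≈y = x≈y
  sign-cong (suc zero)    x≈y = -‿cong x≈y
  sign-cong (suc (suc k)) x≈y = sign-cong k x≈y

  sign-suc : ∀ k x → sign (suc k) x ≈ - sign k x
  sign-suc zero          x = refl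
  sign-suc (suc zero)    x = sym (-‿involutive x)
  sign-suc (suc (suc k)) x = sign-suc k x

  sumFin-cong : ∀ {n} {f g : Fin n → Carrier} → (∀ i → f i ≈ g i) → sumFin f ≈ sumFin g
  sumFin-cong {zero}  f≈g = refl
  sumFin-cong {suc n} f≈g = +-cong (f≈g zero) (sumFin-cong (f≈g ∘ suc))

  sumFin-neg : ∀ {n} (f : Fin n → Carrier) → - sumFin f ≈ sumFin (λ i → - f i)
  sumFin-neg {zero}  f = -0#≈0#
  sumFin-neg {suc n} f = trans (sym (-‿+-comm _ _)) (+-congˡ (sumFin-neg (f ∘ suc)))

  -- Laplace expansion: `insertAt ⊤ j outside` is the complement of {j}, and v_j contributes to the
  -- top coordinate only together with that coordinate of w. The sign counts the basis vectors that
  -- e_j has to pass.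
  wedge-⊤ : ∀ {n} (v : Fin (suc n) → Carrier) w →
            wedge v w ⊤ ≈ sumFin (λ j → sign (toℕ j) (v j * w (insertAt ⊤ j outside)))
  wedge-⊤ {zero}  v w = +-congˡ -0#≈0#
  wedge-⊤ {suc n} v w = +-congˡ (begin
    - wedge (v ∘ suc) (w ∘ (inside ∷_)) ⊤
      ≈⟨ -‿cong (wedge-⊤ (v ∘ suc) (w ∘ (inside ∷_))) ⟩
    - sumFin (λ j → sign (toℕ j) (term j))
      ≈⟨ sumFin-neg (λ j → sign (toℕ j) (term j)) ⟩
    sumFin (λ j → - sign (toℕ j) (term j))
      ≈⟨ sumFin-cong {f = λ j → sign (suc (toℕ j)) (term j)} (λ j → sign-suc (toℕ j) (term j)) ⟨
    sumFin (λ j → sign (suc (toℕ j)) (term j)) ∎)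
    where
    term : Fin (suc n) → Carrier
    term j = v (suc j) * w (inside ∷ insertAt ⊤ j outside)

  -- The top coordinate of the product of the rows satisfies the recursion that defines `det`. By
  -- `wedges-punch`, its coordinate at the complement of {j} is the top coordinate after deleting
  -- column j.
  det≈wedges : ∀ {n} (M : Fin n → Fin n → Carrier) → det M ≈ wedges M ⊤
  det≈wedges {zero}  M = refl
  det≈wedges {suc n} M =
    trans (sumFin-cong {f = λ j → sign (toℕ j) (M zero j * det (λ i → M (suc i) ∘ punchIn j))}
                       (λ j → sign-cong (toℕ j) (*-congˡ (minor j))))
          (sym (wedge-⊤ (M zero) (wedges (M ∘ suc))))
    where
    minor : ∀ j → det (λ i → M (suc i) ∘ punchIn j) ≈ wedges (M ∘ suc) (insertAt ⊤ j outside)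
    minor j = trans (det≈wedges (λ i → M (suc i) ∘ punchIn j)) (sym (wedges-punch (M ∘ suc) j ⊤))

  det-cong : ∀ {n} {M N : Fin n → Fin n → Carrier} → (∀ i j → M i j ≈ N i j) → det M ≈ det N
  det-cong {M = M} {N} M≈N = trans (det≈wedges M) (trans (wedges-cong M≈N ⊤) (sym (det≈wedges N)))

  -- The product of the rows with the i-th factor exchanged for v. Recursion along `wedges`, rather
  -- than an updated matrix, lets linearity and alternation in v follow from those of a single
  -- `wedge`.
  replaceRow : ∀ {p n} → Fin p → (Fin n → Carrier) → (Fin p → Fin n → Carrier) → Subset n → Carrier
  replaceRow zero    v M = wedge v (wedges (M ∘ suc))
  replaceRow (suc i) v M = wedge (M zero) (replaceRow i v (M ∘ suc))

  replaceRow-cong : ∀ {p n} i {u v : Fin n → Carrier} (M : Fin p → Fin n → Carrier) →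
                    (∀ j → u j ≈ v j) → ∀ s → replaceRow i u M s ≈ replaceRow i v M s
  replaceRow-cong zero    M u≈v s = wedge-cong u≈v (λ _ → refl) s
  replaceRow-cong (suc i) M u≈v s = wedge-cong (λ _ → refl) (replaceRow-cong i (M ∘ suc) u≈v) s

  replaceRow-linear : ∀ {p n} i (M : Fin p → Fin n → Carrier) s → LinearFunctional (λ v → replaceRow i v M s)
  replaceRow-linear zero    M s a b u v = wedge-linearˡ a b u v _ s
  replaceRow-linear (suc i) M s a b u v =
    trans (wedge-cong (λ _ → refl) (λ t → replaceRow-linear i (M ∘ suc) t a b u v) s)
          (wedge-linearʳ a b (M zero) _ _ s)

  replaceRow-self : ∀ {p n} i (M : Fin p → Fin n → Carrier) s → replaceRow i (M i) M s ≈ wedges M s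
  replaceRow-self zero    M s = refl
  replaceRow-self (suc i) M s = wedge-cong (λ _ → refl) (replaceRow-self i (M ∘ suc)) s

  private
    wedge-swap-zero : ∀ {n} (u v : Fin n → Carrier) w → (∀ s → wedge u w s ≈ 0#) →
                      ∀ s → wedge u (wedge v w) s ≈ 0#
    wedge-swap-zero u v w u∧w≈0 s =
      trans (wedge-swap u v w s) (trans (-‿cong (wedge-zeroʳ v u∧w≈0 s)) -0#≈0#)

  wedge-row : ∀ {p n} l (M : Fin p → Fin n → Carrier) s → wedge (M l) (wedges M) s ≈ 0#
  wedge-row zero    M s = wedge-square (M zero) _ s
  wedge-row (suc l) M s = wedge-swap-zero (M (suc l)) (M zero) _ (wedge-row l (M ∘ suc)) s

  wedge-replaceRow : ∀ {p n} i (v : Fin n → Carrier) (M : Fin p → Fin n → Carrier) s →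
                     wedge v (replaceRow i v M) s ≈ 0#
  wedge-replaceRow zero    v M s = wedge-square v _ s
  wedge-replaceRow (suc i) v M s = wedge-swap-zero v (M zero) _ (wedge-replaceRow i v (M ∘ suc)) s

  -- The factor `M l` then occurs twice. The factors in front of the first occurrence are harmless,
  -- and the first occurrence is anticommuted up to the second, where `wedge-square` applies.
  replaceRow-other : ∀ {p n} i l → l ≢ i → ∀ (M : Fin p → Fin n → Carrier) s → replaceRow i (M l) M s ≈ 0#
  replaceRow-other zero    zero    l≢i M s = contradiction ≡.refl l≢i
  replaceRow-other zero    (suc l) l≢i M s = wedge-row l (M ∘ suc) s
  replaceRow-other (suc i) zero    l≢i M s = wedge-replaceRow i (M zero) (M ∘ suc) s
  replaceRow-other (suc i) (suc l) l≢i M s =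
    wedge-zeroʳ (M zero) (replaceRow-other i l (l≢i ∘ ≡.cong suc) (M ∘ suc)) s

  -- The cofactor as the determinant with row i exchanged for the j-th unit vector. By linearity,
  -- summing against a row of M puts that row in place of row i, so neither signs nor minors have to
  -- be handled.
  adjugate : ∀ {n} → (Fin n → Fin n → Carrier) → Fin n → Fin n → Carrier
  adjugate M j i = replaceRow i (δ j) M ⊤

  private
    expand-row : ∀ {n} (M : Fin n → Fin n → Carrier) v i →
                 sum (λ j → v j * adjugate M j i) ≈ replaceRow i v M ⊤
    expand-row M v i = sym (expand (λ u → replaceRow i u M ⊤) (λ u≈v → replaceRow-cong i M u≈v ⊤)
                                   (replaceRow-linear i M ⊤) v)

  *-adjugate-diagonal : ∀ {n} (M : Fin n → Fin n → Carrier) i →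
                        sum (λ j → M i j * adjugate M j i) ≈ det M
  *-adjugate-diagonal M i =
    trans (expand-row M (M i) i) (trans (replaceRow-self i M ⊤) (sym (det≈wedges M)))

  *-adjugate-off-diagonal : ∀ {n} (M : Fin n → Fin n → Carrier) l i → l ≢ i →
                            sum (λ j → M l j * adjugate M j i) ≈ 0#
  *-adjugate-off-diagonal M l i l≢i = trans (expand-row M (M l) i) (replaceRow-other i l l≢i M ⊤)

  -- Derivations applied to determinants

  module Derivation
    (D : Carrier → Carrier)
    (D-cong : ∀ {x y} → x ≈ y → D x ≈ D y)
    (D-+ : ∀ x y → D (x + y) ≈ D x + D y)
    (D-* : ∀ x y → D (x * y) ≈ D x * y + x * D y)
    where

    D-0 : D 0# ≈ 0#
    D-0 = trans (D-cong (sym (zeroʳ 0#)))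
      (trans (D-* 0# 0#) (solve 1 (λ x → x :* con (+ 0) :+ con (+ 0) :* x := con (+ 0)) refl _))

    D-1 : D 1# ≈ 0#
    D-1 = begin
      D 1#                               ≈⟨ solve 1 (λ d → d := (d :* con (+ 1) :+ con (+ 1) :* d) :- d) refl _ ⟩
      (D 1# * 1# + 1# * D 1#) - D 1#     ≈⟨ +-congʳ (D-* 1# 1#) ⟨
      D (1# * 1#) - D 1#                 ≈⟨ +-congʳ (D-cong (*-identityˡ 1#)) ⟩
      D 1# - D 1#                        ≈⟨ -‿inverseʳ _ ⟩
      0#                                 ∎

    D-neg : ∀ x → D (- x) ≈ - D x
    D-neg x = begin
      D (- x)                     ≈⟨ solve 2 (λ y z → y := (z :+ y) :- z) refl _ _ ⟩
      (D x + D (- x)) - D x       ≈⟨ +-congʳ (D-+ x (- x)) ⟨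
      D (x - x) - D x             ≈⟨ +-congʳ (trans (D-cong (-‿inverseʳ x)) D-0) ⟩
      0# - D x                    ≈⟨ +-identityˡ _ ⟩
      - D x                       ∎

    D-wedge : ∀ {n} (v : Fin n → Carrier) w s →
              D (wedge v w s) ≈ wedge (D ∘ v) w s + wedge v (D ∘ w) s
    D-wedge v w []            = trans D-0 (sym (+-identityˡ 0#))
    D-wedge v w (outside ∷ s) = D-wedge (v ∘ suc) (w ∘ (outside ∷_)) s
    D-wedge v w (inside ∷ s)  = begin
      D (v zero * w (outside ∷ s) - x)
        ≈⟨ D-+ _ _ ⟩
      D (v zero * w (outside ∷ s)) + D (- x)
        ≈⟨ +-cong (D-* _ _) (trans (D-neg x) (-‿cong (D-wedge (v ∘ suc) (w ∘ (inside ∷_)) s))) ⟩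
      (D (v zero) * w (outside ∷ s) + v zero * D (w (outside ∷ s))) - (y + z)
        ≈⟨ solve 4 (λ p q y z → (p :+ q) :- (y :+ z) := (p :- y) :+ (q :- z)) refl _ _ _ _ ⟩
      (D (v zero) * w (outside ∷ s) - y) + (v zero * D (w (outside ∷ s)) - z) ∎
      where
      x = wedge (v ∘ suc) (w ∘ (inside ∷_)) s
      y = wedge (D ∘ v ∘ suc) (w ∘ (inside ∷_)) s
      z = wedge (v ∘ suc) (D ∘ w ∘ (inside ∷_)) s

    D-one : ∀ {n} (s : Subset n) → D (one s) ≈ 0#
    D-one []            = D-1
    D-one (outside ∷ s) = D-one s
    D-one (inside ∷ s)  = D-0

    -- The Leibniz rule along the product of the rows; the empty product `one` has coordinates 0 and
    -- 1 only, which every derivation kills.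
    D-wedges : ∀ {p n} (M : Fin p → Fin n → Carrier) s →
               D (wedges M s) ≈ sum (λ i → replaceRow i (D ∘ M i) M s)
    D-wedges {zero}  M s = D-one s
    D-wedges {suc p} M s =
      trans (D-wedge (M zero) _ s)
            (+-congˡ (trans (wedge-cong (λ _ → refl) (D-wedges (M ∘ suc)) s)
                            (wedge-sumʳ (M zero) (λ i → replaceRow i (D ∘ M (suc i)) (M ∘ suc)) s)))

    D-det : ∀ {n} (M : Fin n → Fin n → Carrier) → D (det M) ≈ sum (λ i → replaceRow i (D ∘ M i) M ⊤)
    D-det M = trans (D-cong (det≈wedges M)) (D-wedges M ⊤)

-- The characteristic polynomial determines the traces of powers

bounded : ∀ {n} (f : Fin n → ℕ) → ∃ λ b → ∀ i → f i ℕ.≤ b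
bounded {zero}  f = 0 , λ ()
bounded {suc n} f with bounded (f ∘ suc)
... | b , f≤b = f zero ℕ.⊔ b , λ
  { zero    → ℕ.m≤m⊔n (f zero) b
  ; (suc i) → ℕ.≤-trans (f≤b i) (ℕ.m≤n⊔m (f zero) b)
  }

-- Matrices, traces and diagonal matrices

module Matrices {c ℓ : Level} (R : CommutativeRing c ℓ) where
  open CommutativeRing R hiding (zero)
  open IntegerCoefficients R
  open Exterior R using (δ)
  open SemiringSum semiring
  open SemiringExp semiring using (_^_)
  open SetoidReasoning setoid

  Matrix : ℕ → Set c
  Matrix n = Fin n → Fin n → Carrier

  sum-zero : ∀ {n} {f : Fin n → Carrier} → (∀ i → f i ≈ 0#) → sum f ≈ 0#
  sum-zero {n} f≈0 = trans (sum-cong-≋ f≈0) (sum-replicate-zero n)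

  sum-linear : ∀ {n} a (f g : Fin n → Carrier) → sum (λ i → f i + a * g i) ≈ sum f + a * sum g
  sum-linear a f g = trans (∑-distrib-+ f (λ i → a * g i)) (+-congˡ (sym (*-distribˡ-sum a g)))

  sum-δ : ∀ {n} (i : Fin n) (f : Fin n → Carrier) → sum (λ j → δ i j * f j) ≈ f i
  sum-δ zero f = begin
    1# * f zero + sum (λ j → 0# * f (suc j))  ≈⟨ +-cong (*-identityˡ _) (sum-zero {f = λ j → 0# * f (suc j)} (λ j → zeroˡ (f (suc j)))) ⟩
    f zero + 0#                               ≈⟨ +-identityʳ _ ⟩
    f zero                                    ∎
  sum-δ (suc i) f = trans (+-cong (zeroˡ _) (sum-δ i (f ∘ suc))) (+-identityˡ _)

  δ-refl : ∀ {n} (i : Fin n) → δ i i ≈ 1#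
  δ-refl i = reflexive (≡.cong (if_then 1# else 0#) (dec-true (i ≟ i) ≡.refl))

  δ-≢ : ∀ {n} {i j : Fin n} → i ≢ j → δ i j ≈ 0#
  δ-≢ {i = i} {j} i≢j = reflexive (≡.cong (if_then 1# else 0#) (dec-false (i ≟ j) i≢j))

  infixl 7 _·_
  _·_ : ∀ {n} → Matrix n → Matrix n → Matrix n
  (A · B) i j = sum (λ l → A i l * B l j)

  -- The matrix Aˡ B, with the new factor applied to B first. An identity for A B can thus be
  -- substituted inside the power without associativity of the product.
  power· : ∀ {n} → Matrix n → ℕ → Matrix n → Matrix n
  power· A zero    B = B
  power· A (suc l) B = power· A l (A · B)

  trace : ∀ {n} → Matrix n → Carrier
  trace A = sum (λ i → A i i)

  ·-congˡ : ∀ {n} (A : Matrix n) {B C} → (∀ i j → B i j ≈ C i j) → ∀ i j → (A · B) i j ≈ (A · C) i j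
  ·-congˡ A B≈C i j = sum-cong-≋ (λ l → *-congˡ {A i l} (B≈C l j))

  power·-cong : ∀ {n} (A : Matrix n) l {B C} → (∀ i j → B i j ≈ C i j) →
                ∀ i j → power· A l B i j ≈ power· A l C i j
  power·-cong A zero    B≈C = B≈C
  power·-cong A (suc l) B≈C = power·-cong A l (·-congˡ A B≈C)

  ·-linear : ∀ {n} (A : Matrix n) a B C i j → (A · (λ i j → B i j + a * C i j)) i j ≈ (A · B) i j + a * (A · C) i j
  ·-linear A a B C i j = trans
    (sum-cong-≋ (λ l → solve 4 (λ x y a z → x :* (y :+ a :* z) := x :* y :+ a :* (x :* z)) refl (A i l) (B l j) a (C l j)))
    (sum-linear a (λ l → A i l * B l j) (λ l → A i l * C l j))

  power·-linear : ∀ {n} (A : Matrix n) l a B C i j →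
                  power· A l (λ i j → B i j + a * C i j) i j ≈ power· A l B i j + a * power· A l C i j
  power·-linear A zero    a B C i j = refl
  power·-linear A (suc l) a B C i j =
    trans (power·-cong A l (·-linear A a B C) i j) (power·-linear A l a (A · B) (A · C) i j)

  power·-zero : ∀ {n} (A : Matrix n) l i j → power· A l (λ _ _ → 0#) i j ≈ 0#
  power·-zero A zero    i j = refl
  power·-zero A (suc l) i j =
    trans (power·-cong A l (λ i j → sum-zero (λ l → zeroʳ (A i l))) i j) (power·-zero A l i j)

  trace-cong : ∀ {n} {A B : Matrix n} → (∀ i j → A i j ≈ B i j) → trace A ≈ trace B
  trace-cong A≈B = sum-cong-≋ (λ i → A≈B i i)

  diagonal : ∀ {n} → (Fin n → Carrier) → Matrix n
  diagonal d i j = d i * δ i j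

  diagonal-· : ∀ {n} (d : Fin n → Carrier) B i j → (diagonal d · B) i j ≈ d i * B i j
  diagonal-· d B i j = begin
    sum (λ l → d i * δ i l * B l j)     ≈⟨ sum-cong-≋ (λ l → *-assoc (d i) (δ i l) (B l j)) ⟩
    sum (λ l → d i * (δ i l * B l j))   ≈⟨ *-distribˡ-sum (d i) (λ l → δ i l * B l j) ⟨
    d i * sum (λ l → δ i l * B l j)     ≈⟨ *-congˡ (sum-δ i (λ l → B l j)) ⟩
    d i * B i j                         ∎

  diagonal-power· : ∀ {n} (d : Fin n → Carrier) l B i j → power· (diagonal d) l B i j ≈ d i ^ l * B i j
  diagonal-power· d zero    B i j = sym (*-identityˡ _)
  diagonal-power· d (suc l) B i j = begin
    power· (diagonal d) l (diagonal d · B) i j   ≈⟨ diagonal-power· d l (diagonal d · B) i j ⟩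
    d i ^ l * (diagonal d · B) i j               ≈⟨ *-congˡ (diagonal-· d B i j) ⟩
    d i ^ l * (d i * B i j)                      ≈⟨ solve 3 (λ x y z → x :* (y :* z) := (y :* x) :* z) refl _ _ _ ⟩
    d i * d i ^ l * B i j                        ∎

  trace-diagonal-power : ∀ {n} (d : Fin n → Carrier) l → trace (power· (diagonal d) l δ) ≈ sum (λ i → d i ^ l)
  trace-diagonal-power d l = sum-cong-≋ (λ i →
    trans (diagonal-power· d l δ i i) (trans (*-congˡ (δ-refl i)) (*-identityʳ _)))

-- The adjugate of x - A

module CharacteristicPolynomial {c ℓ : Level} (R : CommutativeRing c ℓ) where
  open CommutativeRing R hiding (zero)
  open Poly R
  open IntegerCoefficients R
  open Polynomials R
  open Matrices R
  open Exterior R using (δ)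
  open RingProperties ring
  open SemiringSum semiring
  open SetoidReasoning setoid
  private
    module P = CommutativeRing polyRing
    module PS = SemiringSum P.semiring
    module PE = Exterior polyRing

  coeff-sum : ∀ {n} (f : Fin n → P) t → coeff (PS.sum f) t ≈ sum (λ i → coeff (f i) t)
  coeff-sum {zero}  f t = refl
  coeff-sum {suc n} f t = trans (coeff-+ (f zero) _ t) (+-congˡ (coeff-sum (f ∘ suc) t))

  -- The constant part is kept on the diagonal too, so that diagonal comparison matrices are covered
  -- along with loopless adjacency matrices.
  charMatrix : ∀ {n} → Matrix n → Fin n → Fin n → P
  charMatrix A i j = (if does (i ≟ j) then X else []) +P constP (- A i j)

  charPolynomial : ∀ {n} → Matrix n → P
  charPolynomial A = detP (charMatrix A)

  coeff-charMatrix-* : ∀ {n} (A : Matrix n) i j p t →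
    coeff (charMatrix A i j *P p) t ≈ δ i j * coeff (0# ∷ p) t - A i j * coeff p t
  coeff-charMatrix-* A i j p t = begin
    coeff (charMatrix A i j *P p) t
      ≈⟨ *P-distribʳ p (if does (i ≟ j) then X else []) (constP (- A i j)) t ⟩
    coeff (((if does (i ≟ j) then X else []) *P p) +P (constP (- A i j) *P p)) t
      ≈⟨ coeff-+ ((if does (i ≟ j) then X else []) *P p) _ t ⟩
    coeff ((if does (i ≟ j) then X else []) *P p) t + coeff (constP (- A i j) *P p) t
      ≈⟨ +-cong (coeff-X (does (i ≟ j))) (trans (coeff-constP-* (- A i j) p t) (sym (-‿distribˡ-* _ _))) ⟩
    δ i j * coeff (0# ∷ p) t - A i j * coeff p t ∎
    where
    coeff-X : ∀ b → coeff ((if b then X else []) *P p) t ≈ (if b then 1# else 0#) * coeff (0# ∷ p) t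
    coeff-X true  = trans (coeff-X-* p t) (sym (*-identityˡ _))
    coeff-X false = sym (zeroˡ _)

  deriv-charMatrix : ∀ {n} (A : Matrix n) i j → deriv (charMatrix A i j) ≈P PE.δ i j
  deriv-charMatrix A i j t =
    trans (coeff-deriv (charMatrix A i j) t) (entry (does (i ≟ j)) t)
    where
    entry : ∀ b t → ℕ→R (suc t) * coeff ((if b then X else []) +P constP (- A i j)) (suc t)
                    ≈ coeff (if b then constP 1# else []) t
    entry true  zero    = solve 0 ((con (+ 1) :+ con (+ 0)) :* con (+ 1) := con (+ 1)) refl
    entry true  (suc t) = zeroʳ _
    entry false zero    = zeroʳ _
    entry false (suc t) = zeroʳ _

  -- Stated by coefficients because a coefficient list may end in zeros, so its length is not the
  -- degree.
  Monic : ℕ → P → Set ℓ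
  Monic n p = coeff p n ≈ 1# × (∀ t → n ℕ.< t → coeff p t ≈ 0#)

  module AdjugateCoefficients {n} (A : Matrix n) where

    χ : P
    χ = charPolynomial A

    N : ℕ → Matrix n
    N t i j = coeff (PE.adjugate (charMatrix A) i j) t

    -- The coefficients of x adj(x - A): `N` shifted by one, with the zero matrix at 0.
    N⁻ : ℕ → Matrix n
    N⁻ t i j = coeff (0# ∷ PE.adjugate (charMatrix A) i j) t

    private
      coeff-product : ∀ i j t →
        coeff (PS.sum (λ l → charMatrix A i l *P PE.adjugate (charMatrix A) l j)) t ≈ N⁻ t i j - (A · N t) i j
      coeff-product i j t = begin
        coeff (PS.sum (λ l → charMatrix A i l *P PE.adjugate (charMatrix A) l j)) t
          ≈⟨ coeff-sum (λ l → charMatrix A i l *P PE.adjugate (charMatrix A) l j) t ⟩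
        sum (λ l → coeff (charMatrix A i l *P PE.adjugate (charMatrix A) l j) t)
          ≈⟨ sum-cong-≋ (λ l → trans (coeff-charMatrix-* A i l (PE.adjugate (charMatrix A) l j) t)
                                      (+-congˡ (sym (-1*x≈-x (A i l * N t l j))))) ⟩
        sum (λ l → δ i l * N⁻ t l j + - 1# * (A i l * N t l j))
          ≈⟨ sum-linear (- 1#) (λ l → δ i l * N⁻ t l j) (λ l → A i l * N t l j) ⟩
        sum (λ l → δ i l * N⁻ t l j) + - 1# * (A · N t) i j
          ≈⟨ +-cong (sum-δ i (λ l → N⁻ t l j)) (-1*x≈-x _) ⟩
        N⁻ t i j - (A · N t) i j ∎

    -- Comparison of coefficients in (x - A) adj(x - A) = χ(x).
    recurrence : ∀ t i j → (A · N t) i j ≈ N⁻ t i j + (- coeff χ t) * δ i j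
    recurrence t i j = begin
      (A · N t) i j
        ≈⟨ solve 2 (λ x y → x := y :- (y :- x)) refl _ _ ⟩
      N⁻ t i j - (N⁻ t i j - (A · N t) i j)
        ≈⟨ +-congˡ (-‿cong (trans (sym (coeff-product i j t)) value)) ⟩
      N⁻ t i j - coeff χ t * δ i j
        ≈⟨ +-congˡ (-‿distribˡ-* _ _) ⟩
      N⁻ t i j + (- coeff χ t) * δ i j ∎
      where
      value : coeff (PS.sum (λ l → charMatrix A i l *P PE.adjugate (charMatrix A) l j)) t ≈ coeff χ t * δ i j
      value with i ≟ j
      ... | yes ≡.refl = trans (PE.*-adjugate-diagonal (charMatrix A) i t) (sym (*-identityʳ _))
      ... | no i≢j     = trans (PE.*-adjugate-off-diagonal (charMatrix A) i j i≢j t) (sym (zeroʳ _))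

    -- Jacobi's formula: differentiating row i of x - A gives the i-th unit vector, and the
    -- determinant with this row put in is the i-th diagonal entry of the adjugate.
    trace-N : ∀ t → trace (N t) ≈ ℕ→R (suc t) * coeff χ (suc t)
    trace-N t = begin
      trace (N t)
        ≈⟨ coeff-sum (λ i → PE.adjugate (charMatrix A) i i) t ⟨
      coeff (PS.sum (λ i → PE.adjugate (charMatrix A) i i)) t
        ≈⟨ PS.sum-cong-≋ {n} {λ i → PE.replaceRow i (deriv ∘ charMatrix A i) (charMatrix A) _}
             (λ i → PE.replaceRow-cong i (charMatrix A) (deriv-charMatrix A i) _) t ⟨
      coeff (PS.sum (λ i → PE.replaceRow i (deriv ∘ charMatrix A i) (charMatrix A) _)) t
        ≈⟨ D-det (charMatrix A) t ⟨
      coeff (deriv χ) t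
        ≈⟨ coeff-deriv χ t ⟩
      ℕ→R (suc t) * coeff χ (suc t) ∎
      where
      open PE.Derivation deriv (λ {p} {q} → deriv-cong {p} {q}) deriv-+ deriv-*

    module _ (monic : Monic n χ) where

      -- No degree count of minors is made. Beyond degree n the coefficients of χ vanish, so the
      -- recurrence reads N_t = A N_{t+1} for t ≥ n, and zeros propagate downwards from any common
      -- bound on the lengths of the lists.
      N-vanishes : ∀ t → n ℕ.≤ t → ∀ i j → N t i j ≈ 0#
      N-vanishes t = descend b t (ℕ.m≤n+m b t)
        where
        length-bound : ∃ λ b → ∀ i j → length (PE.adjugate (charMatrix A) i j) ℕ.≤ b
        length-bound with bounded (λ i → proj₁ (bounded (λ j → length (PE.adjugate (charMatrix A) i j))))
        ... | b , ≤b = b , λ i j → ℕ.≤-trans (proj₂ (bounded (λ j → length (PE.adjugate (charMatrix A) i j))) j) (≤b i)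

        b = proj₁ length-bound

        -- `fuel` bounds the distance from t up to the length bound b, where the coefficients vanish
        -- trivially.
        descend : ∀ fuel t → b ℕ.≤ t ℕ.+ fuel → n ℕ.≤ t → ∀ i j → N t i j ≈ 0#
        descend zero t b≤t n≤t i j =
          coeff-length (PE.adjugate (charMatrix A) i j) t (ℕ.≤-trans (proj₂ length-bound i j) (ℕ.≤-trans b≤t (ℕ.≤-reflexive (ℕ.+-identityʳ t))))
        descend (suc fuel) t b≤t n≤t i j = begin
          N t i j
            ≈⟨ solve 3 (λ x c d → x := (x :+ (:- c) :* d) :+ c :* d) refl _ _ _ ⟩
          (N t i j + (- coeff χ (suc t)) * δ i j) + coeff χ (suc t) * δ i j
            ≈⟨ +-congʳ (recurrence (suc t) i j) ⟨
          (A · N (suc t)) i j + coeff χ (suc t) * δ i j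
            ≈⟨ +-cong (sum-zero (λ l → trans (*-congˡ (above l)) (zeroʳ (A i l))))
                      (trans (*-congʳ (proj₂ monic (suc t) (ℕ.s≤s n≤t))) (zeroˡ _)) ⟩
          0# + 0#
            ≈⟨ +-identityˡ 0# ⟩
          0# ∎
          where
          above : ∀ l → N (suc t) l j ≈ 0#
          above l = descend fuel (suc t) (ℕ.≤-trans b≤t (ℕ.≤-reflexive (ℕ.+-suc t fuel))) (ℕ.m≤n⇒m≤1+n n≤t) l j

      -- The recurrence in degree n, where N_n = 0 and the coefficient of χ is 1. This is how Aˡ
      -- itself is recovered from the matrices Aˡ N_t.
      N-top : ∀ t → n ≡ suc t → ∀ i j → N t i j ≈ δ i j
      N-top t ≡.refl i j = begin
        N t i j
          ≈⟨ solve 3 (λ x c d → x := (x :+ (:- c) :* d) :+ c :* d) refl _ _ _ ⟩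
        (N t i j + (- coeff χ (suc t)) * δ i j) + coeff χ (suc t) * δ i j
          ≈⟨ +-congʳ (recurrence (suc t) i j) ⟨
        (A · N (suc t)) i j + coeff χ (suc t) * δ i j
          ≈⟨ +-cong (sum-zero (λ l → trans (*-congˡ (N-vanishes (suc t) ℕ.≤-refl l j)) (zeroʳ (A i l))))
                    (trans (*-congʳ (proj₁ monic)) (*-identityˡ _)) ⟩
        0# + δ i j
          ≈⟨ +-identityˡ _ ⟩
        δ i j ∎

  trace-power·-recurrence : ∀ {n} (A : Matrix n) l t → let open AdjugateCoefficients A in
    trace (power· A (suc l) (N t)) ≈ trace (power· A l (N⁻ t)) + (- coeff χ t) * trace (power· A l δ)
  trace-power·-recurrence A l t = trans
    (trace-cong {A = power· A l (A · N t)} (λ i j → trans (power·-cong A l (recurrence t) i j)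
                                                     (power·-linear A l (- coeff χ t) (N⁻ t) δ i j)))
    (sum-linear (- coeff χ t) (λ i → power· A l (N⁻ t) i i) (λ i → power· A l δ i i))
    where open AdjugateCoefficients A

  module _ {n} (A B : Matrix (suc n)) (χ≈ : charPolynomial A ≈P charPolynomial B)
           (monic : Monic (suc n) (charPolynomial B)) where
    private
      module A = AdjugateCoefficients A
      module B = AdjugateCoefficients B

      monicA : Monic (suc n) A.χ
      monicA = trans (χ≈ (suc n)) (proj₁ monic) , λ t n<t → trans (χ≈ t) (proj₂ monic t n<t)

      -- The induction on l needs tr(Aˡ N_t) for all t besides tr Aˡ. For l = 0 these are the
      -- coefficients of χ′. The recurrence expresses tr(Aˡ⁺¹ N_t) by tr(Aˡ N_{t-1}), tr Aˡ and a
      -- coefficient of χ, and the top index, where N is the identity, then returns tr Aˡ⁺¹.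
      traces : ∀ l → (∀ t → trace (power· A l (A.N t)) ≈ trace (power· B l (B.N t))) ×
                     trace (power· A l δ) ≈ trace (power· B l δ)
      traces zero = (λ t → trans (A.trace-N t) (trans (*-congˡ (χ≈ (suc t))) (sym (B.trace-N t)))) , refl
      traces (suc l) with traces l
      ... | N≈ , δ≈ = advance , (begin
        trace (power· A (suc l) δ)       ≈⟨ trace-cong {A = power· A (suc l) (A.N n)} (power·-cong A (suc l) (A.N-top monicA n ≡.refl)) ⟨
        trace (power· A (suc l) (A.N n)) ≈⟨ advance n ⟩
        trace (power· B (suc l) (B.N n)) ≈⟨ trace-cong {A = power· B (suc l) (B.N n)} (power·-cong B (suc l) (B.N-top monic n ≡.refl)) ⟩
        trace (power· B (suc l) δ)       ∎)
        where
        N⁻≈ : ∀ t → trace (power· A l (A.N⁻ t)) ≈ trace (power· B l (B.N⁻ t))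
        N⁻≈ zero    = trans (sum-zero (λ i → power·-zero A l i i)) (sym (sum-zero (λ i → power·-zero B l i i)))
        N⁻≈ (suc t) = N≈ t

        advance : ∀ t → trace (power· A (suc l) (A.N t)) ≈ trace (power· B (suc l) (B.N t))
        advance t = begin
          trace (power· A (suc l) (A.N t))
            ≈⟨ trace-power·-recurrence A l t ⟩
          trace (power· A l (A.N⁻ t)) + (- coeff A.χ t) * trace (power· A l δ)
            ≈⟨ +-cong (N⁻≈ t) (*-cong (-‿cong (χ≈ t)) δ≈) ⟩
          trace (power· B l (B.N⁻ t)) + (- coeff B.χ t) * trace (power· B l δ)
            ≈⟨ trace-power·-recurrence B l t ⟨
          trace (power· B (suc l) (B.N t)) ∎

    trace-power-determined : ∀ l → trace (power· A l δ) ≈ trace (power· B l δ)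
    trace-power-determined l = proj₂ (traces l)

-- Spectra of graphs

module Diagonal {c ℓ : Level} (R : CommutativeRing c ℓ) where
  open CommutativeRing R hiding (zero)
  open Exterior R using (sign-cong)
  open Det rawRing
  open RingProperties ring
  open MonoidSum *-commutativeMonoid using () renaming (sum to product)

  sign-zero : ∀ k → sign k 0# ≈ 0#
  sign-zero zero          = refl
  sign-zero (suc zero)    = -0#≈0#
  sign-zero (suc (suc k)) = sign-zero k

  sumFin-zero : ∀ {n} {f : Fin n → Carrier} → (∀ i → f i ≈ 0#) → sumFin f ≈ 0#
  sumFin-zero {zero}  f≈0 = refl
  sumFin-zero {suc n} f≈0 = trans (+-cong (f≈0 zero) (sumFin-zero (f≈0 ∘ suc))) (+-identityˡ 0#)

  det-diagonal : ∀ {n} (M : Fin n → Fin n → Carrier) → (∀ i j → i ≢ j → M i j ≈ 0#) →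
                 det M ≈ product (λ i → M i i)
  det-diagonal {zero}  M off = refl
  det-diagonal {suc n} M off = trans
    (+-cong (*-congˡ (det-diagonal (λ i j → M (suc i) (suc j)) (λ i j i≢j → off (suc i) (suc j) (i≢j ∘ Fin.suc-injective))))
            (sumFin-zero {f = λ j → sign (suc (toℕ j)) (M zero (suc j) * det (λ i → M (suc i) ∘ punchIn (suc j)))}
              (λ j → trans (sign-cong (suc (toℕ j)) (trans (*-congʳ (off zero (suc j) λ ())) (zeroˡ _)))
                           (sign-zero (suc (toℕ j))))))
    (+-identityʳ _)

repeats : ∀ {c} {A : Set c} m {m′} → A → A → Fin (m ℕ.+ m′) → A
repeats zero    a b i       = b
repeats (suc m) a b zero    = a
repeats (suc m) a b (suc i) = repeats m a b i

length-filter-map : ∀ {a} {A B : Set a} (f : A → Bool) (g : B → A) xs →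
  length (filter (λ x → f x Bool.≟ true) (map g xs)) ≡ length (filter (λ x → f (g x) Bool.≟ true) xs)
length-filter-map f g []       = ≡.refl
length-filter-map f g (x ∷ xs) with f (g x)
... | true  = ≡.cong suc (length-filter-map f g xs)
... | false = length-filter-map f g xs

length-vertices : ∀ n → length (vertices n) ≡ n
length-vertices zero    = ≡.refl
length-vertices (suc n) = ≡.cong suc (≡.trans (List.length-map suc (vertices n)) (length-vertices n))

degree≤ : ∀ {n} (G : Graph n) i → degree G i ℕ.≤ n
degree≤ {n} G i = ℕ.≤-trans (List.length-filter (λ j → adj G i j Bool.≟ true) (vertices n))
                            (ℕ.≤-reflexive (length-vertices n))

-- Adjacency matrices: power traces and sums of entries

module Spectrum {c ℓ : Level} (R : CommutativeRing c ℓ) where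
  open CommutativeRing R hiding (zero)
  open Poly R
  open IntegerCoefficients R
  open Polynomials R
  open Matrices R
  open CharacteristicPolynomial R
  open Exterior R using (δ)
  open RingProperties ring
  open SemiringSum semiring
  open SemiringExp semiring using (_^_)
  open SetoidReasoning setoid
  private
    module P = CommutativeRing polyRing
    module PP = MonoidSum P.*-commutativeMonoid
    module PE = Exterior polyRing
    module PD = Diagonal polyRing

  coeff-X-‿* : ∀ a p t → coeff (X- a *P p) t ≈ coeff (0# ∷ p) t - a * coeff p t
  coeff-X-‿* a p t = begin
    coeff ((X +P constP (- a)) *P p) t                 ≈⟨ *P-distribʳ p X (constP (- a)) t ⟩
    coeff ((X *P p) +P (constP (- a) *P p)) t          ≈⟨ coeff-+ (X *P p) _ t ⟩
    coeff (X *P p) t + coeff (constP (- a) *P p) t     ≈⟨ +-cong (coeff-X-* p t) (trans (coeff-constP-* (- a) p t) (sym (-‿distribˡ-* _ _))) ⟩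
    coeff (0# ∷ p) t - a * coeff p t                   ∎

  monic-product : ∀ {n} (d : Fin n → Carrier) → Monic n (PP.sum (λ i → X- (d i)))
  monic-product {zero}  d = refl , λ { (suc t) _ → refl }
  monic-product {suc n} d with monic-product (d ∘ suc)
  ... | top , above = leading , higher
    where
    p = PP.sum (λ i → X- (d (suc i)))

    leading : coeff (X- (d zero) *P p) (suc n) ≈ 1#
    leading = begin
      coeff (X- (d zero) *P p) (suc n)             ≈⟨ coeff-X-‿* (d zero) p (suc n) ⟩
      coeff p n - d zero * coeff p (suc n)         ≈⟨ +-cong top (-‿cong (*-congˡ (above (suc n) ℕ.≤-refl))) ⟩
      1# - d zero * 0#                             ≈⟨ solve 1 (λ a → con (+ 1) :- a :* con (+ 0) := con (+ 1)) refl _ ⟩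
      1#                                           ∎

    higher : ∀ t → suc n ℕ.< t → coeff (X- (d zero) *P p) t ≈ 0#
    higher (suc t) (ℕ.s≤s n<t) = begin
      coeff (X- (d zero) *P p) (suc t)             ≈⟨ coeff-X-‿* (d zero) p (suc t) ⟩
      coeff p t - d zero * coeff p (suc t)         ≈⟨ +-cong (above t n<t) (-‿cong (*-congˡ (above (suc t) (ℕ.m≤n⇒m≤1+n n<t)))) ⟩
      0# - d zero * 0#                             ≈⟨ solve 1 (λ a → con (+ 0) :- a :* con (+ 0) := con (+ 0)) refl _ ⟩
      0#                                           ∎

  charPolynomial-diagonal : ∀ {n} (d : Fin n → Carrier) →
                            charPolynomial (diagonal d) ≈P PP.sum (λ i → X- (d i))
  charPolynomial-diagonal {n} d t = trans
    (PD.det-diagonal (charMatrix (diagonal d)) off t)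
    (PP.sum-cong-≋ {n} {λ i → charMatrix (diagonal d) i i} {λ i → X- (d i)} on t)
    where
    off : ∀ i j → i ≢ j → charMatrix (diagonal d) i j ≈P []
    off i j i≢j t with i ≟ j
    off i j i≢j t       | yes i≡j = contradiction i≡j i≢j
    off i j i≢j zero    | no _    = solve 1 (λ x → :- (x :* con (+ 0)) := con (+ 0)) refl _
    off i j i≢j (suc t) | no _    = refl

    on : ∀ i → charMatrix (diagonal d) i i ≈P X- (d i)
    on i t with i ≟ i
    on i t       | no i≢i = contradiction ≡.refl i≢i
    on i zero    | yes _  = +-congˡ (-‿cong (*-identityʳ _))
    on i (suc t) | yes _  = refl

  -- The diagonal of the comparison matrix, whose characteristic polynomial is the prescribed
  -- product by construction.
  eigenvalues : Carrier → ∀ m {m′} → Carrier → Carrier → Fin (2 ℕ.+ (m ℕ.+ m′)) → Carrier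
  eigenvalues κ m α β zero          = κ
  eigenvalues κ m α β (suc zero)    = - 1#
  eigenvalues κ m α β (suc (suc i)) = repeats m α β i

  product-const : ∀ m p → PP.sum {m} (λ _ → p) ≈P (p ^P m)
  product-const zero    p t = refl
  product-const (suc m) p t = *P-congˡ p {PP.sum {m} (λ _ → p)} {p ^P m} (product-const m p) t

  product-repeats : ∀ m {m′} α β → PP.sum {m ℕ.+ m′} (λ i → X- (repeats m α β i)) ≈P ((X- α ^P m) *P (X- β ^P m′))
  product-repeats zero    {m′} α β t =
    trans (product-const m′ (X- β) t) (sym (P.*-identityˡ (X- β ^P m′) t))
  product-repeats (suc m) {m′} α β t = trans
    (*P-congˡ (X- α) {PP.sum (λ i → X- (repeats m α β i))} {(X- α ^P m) *P (X- β ^P m′)} (product-repeats m α β) t)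
    (sym (*P-assoc (X- α) (X- α ^P m) (X- β ^P m′) t))

  product-eigenvalues : ∀ κ m {m′} α β → PP.sum (λ i → X- (eigenvalues κ m {m′} α β i)) ≈P
                        (X- κ *P (X- (- 1#) *P ((X- α ^P m) *P (X- β ^P m′))))
  product-eigenvalues κ m {m′} α β =
    *P-congˡ (X- κ) {X- (- 1#) *P p} {X- (- 1#) *P q} (*P-congˡ (X- (- 1#)) {p} {q} (product-repeats m α β))
    where
    p = PP.sum {m ℕ.+ m′} (λ i → X- (repeats m α β i))
    q = (X- α ^P m) *P (X- β ^P m′)

  sum-const : ∀ n x → sum {n} (λ _ → x) ≈ ℕ→R n * x
  sum-const zero    x = sym (zeroˡ x)
  sum-const (suc n) x = trans (+-congˡ (sum-const n x))
    (solve 2 (λ x y → x :+ y :* x := (con (+ 1) :+ y) :* x) refl _ _)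

  sum-repeats : ∀ m {m′} (f : Carrier → Carrier) α β →
                sum {m ℕ.+ m′} (λ i → f (repeats m α β i)) ≈ ℕ→R m * f α + ℕ→R m′ * f β
  sum-repeats zero    {m′} f α β = trans (sum-const m′ (f β)) (sym (trans (+-congʳ (zeroˡ _)) (+-identityˡ _)))
  sum-repeats (suc m) {m′} f α β = trans (+-congˡ (sum-repeats m f α β))
    (solve 3 (λ x y z → x :+ (y :* x :+ z) := (con (+ 1) :+ y) :* x :+ z) refl _ _ _)

  adjacency : ∀ {n} → Graph n → Matrix n
  adjacency G i j = if adj G i j then 1# else 0#

  charPoly≈charPolynomial : ∀ {n} (G : Graph n) → charPoly G ≈P charPolynomial (adjacency G)
  charPoly≈charPolynomial G = PE.det-cong entry
    where
    entry : ∀ i j → (if does (i ≟ j) then X else (if adj G i j then constP (- 1#) else [])) ≈P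
                    charMatrix (adjacency G) i j
    entry i j t with i ≟ j
    entry i j t       | yes ≡.refl rewrite loopless G i = diagonal-entry t
      where
      diagonal-entry : X ≈P (X +P constP (- 0#))
      diagonal-entry zero    = solve 0 (con (+ 0) := con (+ 0) :- con (+ 0)) refl
      diagonal-entry (suc t) = refl
    entry i j t       | no _ with adj G i j
    entry i j t       | no _ | true  = refl
    entry i j zero    | no _ | false = sym -0#≈0#
    entry i j (suc t) | no _ | false = refl

  trace-adjacency-power : ∀ m {m′} (G : Graph (2 ℕ.+ (m ℕ.+ m′))) κ α β →
    charPoly G ≈P (X- κ *P (X- (- 1#) *P ((X- α ^P m) *P (X- β ^P m′)))) →
    ∀ l → trace (power· (adjacency G) l δ) ≈ κ ^ l + ((- 1#) ^ l + (ℕ→R m * α ^ l + ℕ→R m′ * β ^ l))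
  trace-adjacency-power m {m′} G κ α β χ≈ l = begin
    trace (power· (adjacency G) l δ)
      ≈⟨ trace-power-determined (adjacency G) (diagonal d) same-χ monic l ⟩
    trace (power· (diagonal d) l δ)
      ≈⟨ trace-diagonal-power d l ⟩
    sum (λ i → d i ^ l)
      ≈⟨ +-congˡ (+-congˡ (sum-repeats m (_^ l) α β)) ⟩
    κ ^ l + ((- 1#) ^ l + (ℕ→R m * α ^ l + ℕ→R m′ * β ^ l)) ∎
    where
    d = eigenvalues κ m {m′} α β

    same-χ : charPolynomial (adjacency G) ≈P charPolynomial (diagonal d)
    same-χ t = begin
      coeff (charPolynomial (adjacency G)) t   ≈⟨ charPoly≈charPolynomial G t ⟨
      coeff (charPoly G) t                     ≈⟨ χ≈ t ⟩
      coeff (X- κ *P (X- (- 1#) *P ((X- α ^P m) *P (X- β ^P m′)))) t ≈⟨ product-eigenvalues κ m α β t ⟨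
      coeff (PP.sum (λ i → X- (d i))) t        ≈⟨ charPolynomial-diagonal d t ⟨
      coeff (charPolynomial (diagonal d)) t    ∎

    monic : Monic (2 ℕ.+ (m ℕ.+ m′)) (charPolynomial (diagonal d))
    monic with monic-product d
    ... | top , above = trans (charPolynomial-diagonal d _) top
                      , λ t n<t → trans (charPolynomial-diagonal d t) (above t n<t)

  sum-adjacency : ∀ {n} (G : Graph n) i → sum (adjacency G i) ≈ ℕ→R (degree G i)
  sum-adjacency G i = count (adj G i)
    where
    count : ∀ {n} (f : Fin n → Bool) →
            sum (λ j → if f j then 1# else 0#) ≈ ℕ→R (length (filter (λ j → f j Bool.≟ true) (vertices n)))
    count {zero}  f = refl
    count {suc n} f with f zero
    ... | true  = +-congˡ (trans (count (f ∘ suc)) (reflexive (≡.cong ℕ→R (≡.sym (length-filter-map f suc (vertices n))))))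
    ... | false = trans (+-identityˡ _)
                        (trans (count (f ∘ suc)) (reflexive (≡.cong ℕ→R (≡.sym (length-filter-map f suc (vertices n))))))

  total : ∀ {n} → Matrix n → Carrier
  total A = sum (λ i → sum (A i))

  total-cong : ∀ {n} {A B : Matrix n} → (∀ i j → A i j ≈ B i j) → total A ≈ total B
  total-cong A≈B = sum-cong-≋ (λ i → sum-cong-≋ (A≈B i))

  total-linear : ∀ {n} a (A B : Matrix n) → total (λ i j → A i j + a * B i j) ≈ total A + a * total B
  total-linear a A B = trans (sum-cong-≋ (λ i → sum-linear a (A i) (B i)))
                             (sum-linear a (λ i → sum (A i)) (λ i → sum (B i)))

  total-δ-* : ∀ {n} (A : Matrix n) → total (λ i j → δ i j * A i j) ≈ trace A
  total-δ-* A = sum-cong-≋ (λ i → sum-δ i (A i))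

  total-const : ∀ {n} x → total {n} (λ _ _ → x) ≈ ℕ→R n * (ℕ→R n * x)
  total-const {n} x = trans (sum-cong-≋ {n} (λ _ → sum-const n x)) (sum-const n (ℕ→R n * x))

  ·-assoc : ∀ {n} (A B C : Matrix n) i j → ((A · B) · C) i j ≈ (A · (B · C)) i j
  ·-assoc A B C i j = begin
    sum (λ l → sum (λ l′ → A i l′ * B l′ l) * C l j)
      ≈⟨ sum-cong-≋ (λ l → trans (*-distribʳ-sum (C l j) (λ l′ → A i l′ * B l′ l))
                                 (sum-cong-≋ (λ l′ → *-assoc (A i l′) (B l′ l) (C l j)))) ⟩
    sum (λ l → sum (λ l′ → A i l′ * (B l′ l * C l j)))
      ≈⟨ ∑-comm (λ l l′ → A i l′ * (B l′ l * C l j)) ⟩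
    sum (λ l′ → sum (λ l → A i l′ * (B l′ l * C l j)))
      ≈⟨ sum-cong-≋ (λ l′ → *-distribˡ-sum (A i l′) (λ l → B l′ l * C l j)) ⟨
    sum (λ l′ → A i l′ * sum (λ l → B l′ l * C l j)) ∎

  ·-δ : ∀ {n} (A : Matrix n) i j → (A · δ) i j ≈ A i j
  ·-δ A i j = trans (sum-cong-≋ (λ l → trans (*-comm (A i l) (δ l j)) (*-congʳ (δ-sym l j)))) (sum-δ j (A i))
    where
    δ-sym : ∀ {n} (i j : Fin n) → δ i j ≈ δ j i
    δ-sym i j with i ≟ j
    ... | yes ≡.refl = sym (δ-refl i)
    ... | no i≢j     = sym (δ-≢ (i≢j ∘ ≡.sym))

  Symmetric : ∀ {n} → Matrix n → Set ℓ
  Symmetric A = ∀ i j → A i j ≈ A j i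

  adjacency-symmetric : ∀ {n} (G : Graph n) → Symmetric (adjacency G)
  adjacency-symmetric G i j = reflexive (≡.cong (if_then 1# else 0#) (symmetric G i j))

  square-symmetric : ∀ {n} {A : Matrix n} → Symmetric A → Symmetric (A · A)
  square-symmetric {A = A} A-sym i j =
    sum-cong-≋ (λ l → trans (*-cong (A-sym i l) (A-sym l j)) (*-comm (A l i) (A j l)))

  -- For symmetric B the trace is the entrywise inner product. It converts sums of products of
  -- entries into traces of powers and back.
  trace-· : ∀ {n} (A B : Matrix n) → Symmetric B → trace (A · B) ≈ total (λ i j → A i j * B i j)
  trace-· A B B-sym = sum-cong-≋ (λ i → sum-cong-≋ (λ j → *-congˡ {A i j} (B-sym j i)))

  module _ {n} (A : Matrix n) (A-sym : Symmetric A) where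

    trace-power₁ : trace (power· A 1 δ) ≈ trace A
    trace-power₁ = trace-cong (·-δ A)

    trace-power₂ : trace (power· A 2 δ) ≈ trace (A · A)
    trace-power₂ = trace-cong (·-congˡ A (·-δ A))

    trace-power₃ : trace (power· A 3 δ) ≈ total (λ i j → (A · A) i j * A i j)
    trace-power₃ = trans (trace-cong (λ i j → trans (·-congˡ A (·-congˡ A (·-δ A)) i j) (sym (·-assoc A A A i j))))
                         (trace-· (A · A) A A-sym)

    trace-power₄ : trace (power· A 4 δ) ≈ total (λ i j → (A · A) i j * (A · A) i j)
    trace-power₄ = trans (trace-cong (λ i j → trans (·-congˡ A (·-congˡ A (·-congˡ A (·-δ A))) i j) (sym (·-assoc A A (A · A) i j))))
                         (trace-· (A · A) (A · A) (square-symmetric A-sym))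

  total-· : ∀ {n} (A B : Matrix n) κ → (∀ i → sum (B i) ≈ κ) → total (A · B) ≈ total A * κ
  total-· A B κ rows = begin
    sum (λ i → sum (λ j → sum (λ l → A i l * B l j)))
      ≈⟨ sum-cong-≋ (λ i → ∑-comm (λ j l → A i l * B l j)) ⟩
    sum (λ i → sum (λ l → sum (λ j → A i l * B l j)))
      ≈⟨ sum-cong-≋ (λ i → sum-cong-≋ (λ l → trans (sym (*-distribˡ-sum (A i l) (B l))) (*-congˡ (rows l)))) ⟩
    sum (λ i → sum (λ l → A i l * κ))
      ≈⟨ sum-cong-≋ (λ i → *-distribʳ-sum κ (A i)) ⟨
    sum (λ i → sum (A i) * κ)
      ≈⟨ *-distribʳ-sum κ (λ i → sum (A i)) ⟨
    total A * κ ∎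

  module _ {n k} (G : Graph n) (regular : Regular G k) where

    private A = adjacency G

    row-sum : ∀ i → sum (A i) ≈ ℕ→R k
    row-sum i = trans (sum-adjacency G i) (reflexive (≡.cong ℕ→R (regular i)))

    total-adjacency : total A ≈ ℕ→R n * ℕ→R k
    total-adjacency = trans (sum-cong-≋ row-sum) (sum-const n (ℕ→R k))

    total-adjacency² : total (A · A) ≈ ℕ→R n * ℕ→R k * ℕ→R k
    total-adjacency² = trans (total-· A A (ℕ→R k) row-sum) (*-congʳ total-adjacency)

    adjacency-idempotent : ∀ i j → A i j * A i j ≈ A i j
    adjacency-idempotent i j with adj G i j
    ... | true  = *-identityˡ 1#
    ... | false = zeroˡ 0#

    trace-adjacency : trace A ≈ 0#
    trace-adjacency = sum-zero (λ i → reflexive (≡.cong (if_then 1# else 0#) (loopless G i)))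

    trace-adjacency² : trace (A · A) ≈ ℕ→R n * ℕ→R k
    trace-adjacency² = begin
      trace (A · A)                        ≈⟨ trace-· A A (adjacency-symmetric G) ⟩
      total (λ i j → A i j * A i j)        ≈⟨ total-cong adjacency-idempotent ⟩
      total A                              ≈⟨ total-adjacency ⟩
      ℕ→R n * ℕ→R k                        ∎

-- Integrality in a field of characteristic zero

module FieldProperties {c ℓ : Level} (F : CharZeroField c ℓ) where
  open CharZeroField F hiding (zero)
  open IntegerCoefficients commutativeRing
  open RingProperties ring
  open CommutativeSemiringExp commutativeSemiring using (_^_)
  open SemiringSum semiring
  open Matrices commutativeRing using (Matrix; power·)
  open Exterior commutativeRing using (δ)
  open Spectrum commutativeRing using (adjacency)
  open SetoidReasoning setoid

  x-y≈0⇒x≈y : ∀ {x y} → x - y ≈ 0# → x ≈ y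
  x-y≈0⇒x≈y {x} {y} x-y≈0 = begin
    x             ≈⟨ solve 2 (λ x y → x := (x :- y) :+ y) refl x y ⟩
    (x - y) + y   ≈⟨ +-congʳ x-y≈0 ⟩
    0# + y        ≈⟨ +-identityˡ y ⟩
    y             ∎

  x≈y⇒x-y≈0 : ∀ {x y} → x ≈ y → x - y ≈ 0#
  x≈y⇒x-y≈0 {x} {y} x≈y = trans (+-congʳ x≈y) (-‿inverseʳ y)

  cancelˡ : ∀ {x y z} → x ≉ 0# → x * y ≈ x * z → y ≈ z
  cancelˡ {x} {y} {z} x≉0 xy≈xz with inverse x x≉0
  ... | x⁻¹ , xx⁻¹≈1 = begin
    y               ≈⟨ *-identityˡ y ⟨
    1# * y          ≈⟨ *-congʳ xx⁻¹≈1 ⟨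
    (x * x⁻¹) * y   ≈⟨ solve 3 (λ x y w → (x :* w) :* y := w :* (x :* y)) refl x y x⁻¹ ⟩
    x⁻¹ * (x * y)   ≈⟨ *-congˡ xy≈xz ⟩
    x⁻¹ * (x * z)   ≈⟨ solve 3 (λ x y w → (x :* w) :* y := w :* (x :* y)) refl x z x⁻¹ ⟨
    (x * x⁻¹) * z   ≈⟨ *-congʳ xx⁻¹≈1 ⟩
    1# * z          ≈⟨ *-identityˡ z ⟩
    z               ∎

  *-≉0 : ∀ {x y} → x ≉ 0# → y ≉ 0# → x * y ≉ 0#
  *-≉0 {x} x≉0 y≉0 xy≈0 = y≉0 (cancelˡ x≉0 (trans xy≈0 (sym (zeroʳ x))))

  ℕ→R-injective : ∀ m n → ℕ→R m ≈ ℕ→R n → m ≡ n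
  ℕ→R-injective zero    zero    _   = ≡.refl
  ℕ→R-injective zero    (suc n) 0≈n = contradiction (sym 0≈n) (charZero n)
  ℕ→R-injective (suc m) zero    m≈0 = contradiction m≈0 (charZero m)
  ℕ→R-injective (suc m) (suc n) m≈n = ≡.cong suc (ℕ→R-injective m n (begin
    ℕ→R m               ≈⟨ solve 1 (λ x → x := (con (+ 1) :+ x) :- con (+ 1)) refl _ ⟩
    (1# + ℕ→R m) - 1#   ≈⟨ +-congʳ m≈n ⟩
    (1# + ℕ→R n) - 1#   ≈⟨ solve 1 (λ x → x := (con (+ 1) :+ x) :- con (+ 1)) refl _ ⟨
    ℕ→R n               ∎))

  IsInteger : Carrier → Set ℓ
  IsInteger x = ∃ λ z → x ≈ ℤ→R z

  integer-resp : ∀ {x y} → x ≈ y → IsInteger x → IsInteger y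
  integer-resp x≈y (z , x≈z) = z , trans (sym x≈y) x≈z

  integer-ℕ : ∀ n → IsInteger (ℕ→R n)
  integer-ℕ n = + n , refl

  integer-0 : IsInteger 0#
  integer-0 = + 0 , refl

  integer-1 : IsInteger 1#
  integer-1 = + 1 , sym (+-identityʳ 1#)

  integer-+ : ∀ {x y} → IsInteger x → IsInteger y → IsInteger (x + y)
  integer-+ (i , x≈i) (j , y≈j) = i ℤ.+ j , trans (+-cong x≈i y≈j) (sym (ℤ→R-+ i j))

  integer-* : ∀ {x y} → IsInteger x → IsInteger y → IsInteger (x * y)
  integer-* (i , x≈i) (j , y≈j) = i ℤ.* j , trans (*-cong x≈i y≈j) (sym (ℤ→R-* i j))

  integer-neg : ∀ {x} → IsInteger x → IsInteger (- x)
  integer-neg (i , x≈i) = ℤ.- i , trans (-‿cong x≈i) (sym (ℤ→R-neg i))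

  integer-- : ∀ {x y} → IsInteger x → IsInteger y → IsInteger (x - y)
  integer-- ix iy = integer-+ ix (integer-neg iy)

  integer-^ : ∀ {x} n → IsInteger x → IsInteger (x ^ n)
  integer-^ zero    ix = integer-1
  integer-^ (suc n) ix = integer-* ix (integer-^ n ix)

  integer-sum : ∀ {n} {f : Fin n → Carrier} → (∀ i → IsInteger (f i)) → IsInteger (sum f)
  integer-sum {zero}  int = integer-0
  integer-sum {suc n} int = integer-+ (int zero) (integer-sum (int ∘ suc))

  integer-δ : ∀ {n} (i j : Fin n) → IsInteger (δ i j)
  integer-δ i j with i ≟ j
  ... | yes _ = integer-1
  ... | no _  = integer-0

  integer-adjacency : ∀ {n} (G : Graph n) i j → IsInteger (adjacency G i j)
  integer-adjacency G i j with adj G i j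
  ... | true  = integer-1
  ... | false = integer-0

  integer-power· : ∀ {n} {A : Matrix n} → (∀ i j → IsInteger (A i j)) →
                   ∀ l {B : Matrix n} → (∀ i j → IsInteger (B i j)) → ∀ i j → IsInteger (power· A l B i j)
  integer-power· intA zero    intB = intB
  integer-power· intA (suc l) intB =
    integer-power· intA l (λ i j → integer-sum (λ l → integer-* (intA i l) (intB l j)))

  ℤ→R≉0 : ∀ {z} → z ≢ + 0 → ℤ→R z ≉ 0#
  ℤ→R≉0 {+ zero}      z≢0 _   = z≢0 ≡.refl
  ℤ→R≉0 {+ suc n}     _   z≈0 = charZero n z≈0
  ℤ→R≉0 { -[1+ n ]}   _   z≈0 = charZero n (begin
    ℕ→R (suc n)      ≈⟨ -‿involutive _ ⟨
    - - ℕ→R (suc n)  ≈⟨ -‿cong z≈0 ⟩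
    - 0#             ≈⟨ -0#≈0# ⟩
    0#               ∎)

  -- If c x = z with c ∤ z, then the remainder r of z mod c is a smaller common
  -- denominator, because r = c (x - q) for the quotient q.
  integer-of-bounded-denominators :
    ∀ {c x} → IsInteger c → c ≉ 0# → (∀ j → IsInteger (c * x ^ j)) → IsInteger x
  integer-of-bounded-denominators {c} {x} (a , c≈a) c≉0 int =
    <-rec Claim claim ℤ.∣ a ∣ a ≡.refl (λ a≡0 → c≉0 (trans c≈a (reflexive (≡.cong ℤ→R a≡0))))
      (λ j → integer-resp (*-congʳ c≈a) (int j))
    where
    Claim : ℕ → Set ℓ
    Claim n = ∀ a → ℤ.∣ a ∣ ≡ n → a ≢ + 0 → (∀ j → IsInteger (ℤ→R a * x ^ j)) → IsInteger x

    claim : ∀ n → (∀ {m} → m ℕ.< n → Claim m) → Claim n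
    claim n smaller a ∣a∣≡n a≢0 int with int 1
    ... | z , ax≈z = continue (z ℤ.% a) ≡.refl
      where
      instance
        a-nonZero : ℤ.NonZero a
        a-nonZero = ℤ.≢-nonZero a≢0

      q = z ℤ./ a

      division : ℤ→R (+ (z ℤ.% a)) ≈ ℤ→R a * x - ℤ→R q * ℤ→R a
      division = begin
        ℤ→R (+ (z ℤ.% a))
          ≈⟨ solve 2 (λ r s → r := (r :+ s) :- s) refl _ _ ⟩
        (ℤ→R (+ (z ℤ.% a)) + ℤ→R q * ℤ→R a) - ℤ→R q * ℤ→R a
          ≈⟨ +-congʳ (trans (ℤ→R-+ (+ (z ℤ.% a)) (q ℤ.* a)) (+-congˡ (ℤ→R-* q a))) ⟨
        ℤ→R (+ (z ℤ.% a) ℤ.+ q ℤ.* a) - ℤ→R q * ℤ→R a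
          ≡⟨ ≡.cong (λ i → ℤ→R i - ℤ→R q * ℤ→R a) (ℤ.a≡a%n+[a/n]*n z a) ⟨
        ℤ→R z - ℤ→R q * ℤ→R a
          ≈⟨ +-congʳ (trans (sym ax≈z) (*-congˡ (*-identityʳ x))) ⟩
        ℤ→R a * x - ℤ→R q * ℤ→R a ∎

      continue : ∀ r → z ℤ.% a ≡ r → IsInteger x
      continue zero r≡0 = q , cancelˡ (ℤ→R≉0 a≢0) (x-y≈0⇒x≈y (begin
        ℤ→R a * x - ℤ→R a * ℤ→R q   ≈⟨ +-congˡ (-‿cong (*-comm _ _)) ⟩
        ℤ→R a * x - ℤ→R q * ℤ→R a   ≈⟨ division ⟨
        ℤ→R (+ (z ℤ.% a))           ≡⟨ ≡.cong (λ r → ℤ→R (+ r)) r≡0 ⟩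
        0#                          ∎))
      continue (suc r) r≡ = smaller (≡.subst₂ ℕ._<_ r≡ ∣a∣≡n (ℤ.n%d<d z a)) (+ suc r) ≡.refl (λ ())
        (λ j → integer-resp (begin
          ℤ→R a * x ^ suc j - ℤ→R q * (ℤ→R a * x ^ j)
            ≈⟨ solve 4 (λ a x q y → a :* (x :* y) :- q :* (a :* y) := (a :* x :- q :* a) :* y) refl _ _ _ _ ⟩
          (ℤ→R a * x - ℤ→R q * ℤ→R a) * x ^ j
            ≈⟨ *-congʳ division ⟨
          ℤ→R (+ (z ℤ.% a)) * x ^ j
            ≡⟨ ≡.cong (λ r → ℤ→R (+ r) * x ^ j) r≡ ⟩
          ℤ→R (+ suc r) * x ^ j ∎)
          (integer-- (int (suc j)) (integer-* {ℤ→R q} (q , refl) (int j))))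

  -- Stands in for nonnegativity, as F has no order.
  IsNatural : Carrier → Set ℓ
  IsNatural x = ∃ λ n → x ≈ ℕ→R n

  natural-sum : ∀ {n} {f : Fin n → Carrier} → (∀ i → IsNatural (f i)) → IsNatural (sum f)
  natural-sum {zero}  nat = 0 , refl
  natural-sum {suc n} nat with nat zero | natural-sum (nat ∘ suc)
  ... | a , f₀≈a | b , f₊≈b = a ℕ.+ b , trans (+-cong f₀≈a f₊≈b) (sym (ℕ→R-+ a b))

  natural-square-- : ∀ {x} → IsInteger x → IsNatural (x * x - x)
  natural-square-- {x} (+ zero , x≈0) = 0 , (begin
    x * x - x      ≈⟨ +-cong (*-cong x≈0 x≈0) (-‿cong x≈0) ⟩
    0# * 0# - 0#   ≈⟨ solve 0 (con (+ 0) :* con (+ 0) :- con (+ 0) := con (+ 0)) refl ⟩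
    0#             ∎)
  natural-square-- {x} (+ suc n , x≈1+n) = suc n ℕ.* n , (begin
    x * x - x                                ≈⟨ +-cong (*-cong x≈1+n x≈1+n) (-‿cong x≈1+n) ⟩
    ℕ→R (suc n) * ℕ→R (suc n) - ℕ→R (suc n)  ≈⟨ solve 1 (λ y → (con (+ 1) :+ y) :* (con (+ 1) :+ y) :- (con (+ 1) :+ y) := (con (+ 1) :+ y) :* y) refl _ ⟩
    ℕ→R (suc n) * ℕ→R n                      ≈⟨ ℕ→R-* (suc n) n ⟨
    ℕ→R (suc n ℕ.* n)                        ∎)
  natural-square-- {x} (-[1+ n ] , x≈) = suc n ℕ.* suc n ℕ.+ suc n , (begin
    x * x - x                                          ≈⟨ +-cong (*-cong x≈ x≈) (-‿cong x≈) ⟩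
    - ℕ→R (suc n) * - ℕ→R (suc n) - - ℕ→R (suc n)      ≈⟨ solve 1 (λ y → :- y :* :- y :- :- y := y :* y :+ y) refl _ ⟩
    ℕ→R (suc n) * ℕ→R (suc n) + ℕ→R (suc n)            ≈⟨ +-congʳ (ℕ→R-* (suc n) (suc n)) ⟨
    ℕ→R (suc n ℕ.* suc n) + ℕ→R (suc n)                ≈⟨ ℕ→R-+ (suc n ℕ.* suc n) (suc n) ⟨
    ℕ→R (suc n ℕ.* suc n ℕ.+ suc n)                    ∎)

-- Power sums of α and β and their Hankel determinants

module PowerSums {c ℓ : Level} (F : CharZeroField c ℓ) (m m′ : ℕ) (m≢0 : m ≢ 0) (m′≢0 : m′ ≢ 0)
  (α β : CharZeroField.Carrier F) where
  open CharZeroField F hiding (zero)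
  open IntegerCoefficients commutativeRing
  open CommutativeSemiringExp commutativeSemiring using (_^_; ^-distrib-*)
  open FieldProperties F
  open SetoidReasoning setoid

  s : ℕ → Carrier
  s j = ℕ→R m * α ^ j + ℕ→R m′ * β ^ j

  h : Carrier
  h = s 0 * s 2 - s 1 * s 1

  module _ (integer-s : ∀ j → IsInteger (s j)) (α≉β : α ≉ β) where

    private
      M  = ℕ→R m
      M′ = ℕ→R m′

      ℕ→R≉0 : ∀ {n} → n ≢ 0 → ℕ→R n ≉ 0#
      ℕ→R≉0 {n} n≢0 n≈0 = n≢0 (ℕ→R-injective n 0 n≈0)

      α-β≉0 : α - β ≉ 0#
      α-β≉0 = α≉β ∘ x-y≈0⇒x≈y

    integer-h : IsInteger h
    integer-h = integer-- (integer-* (integer-s 0) (integer-s 2)) (integer-* (integer-s 1) (integer-s 1))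

    h≈ : h ≈ M * M′ * ((α - β) * (α - β))
    -- The solver is given the powers as `_^_` unfolds them, each ending in a factor 1.
    h≈ = solve 4 (λ M M′ a b →
           (M :* con (+ 1) :+ M′ :* con (+ 1)) :* (M :* (a :* (a :* con (+ 1))) :+ M′ :* (b :* (b :* con (+ 1))))
             :- (M :* (a :* con (+ 1)) :+ M′ :* (b :* con (+ 1))) :* (M :* (a :* con (+ 1)) :+ M′ :* (b :* con (+ 1)))
           := M :* M′ :* ((a :- b) :* (a :- b))) refl M M′ α β

    h≉0 : h ≉ 0#
    h≉0 h≈0 = *-≉0 (*-≉0 (ℕ→R≉0 m≢0) (ℕ→R≉0 m′≢0)) (*-≉0 α-β≉0 α-β≉0) (trans (sym h≈) h≈0)

    -- Cramer's rule for the equations s₂ = σ s₁ - τ s₀ and s₃ = σ s₂ - τ s₁ in the unknowns σ and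
    -- τ, whose determinant is h up to sign.
    integer-hσ : IsInteger (h * (α + β))
    integer-hσ = integer-resp (begin
      s 0 * s 3 - s 1 * s 2
        ≈⟨ solve 4 (λ M M′ a b →
             (M :* con (+ 1) :+ M′ :* con (+ 1)) :* (M :* (a :* (a :* (a :* con (+ 1)))) :+ M′ :* (b :* (b :* (b :* con (+ 1)))))
               :- (M :* (a :* con (+ 1)) :+ M′ :* (b :* con (+ 1))) :* (M :* (a :* (a :* con (+ 1))) :+ M′ :* (b :* (b :* con (+ 1))))
             := M :* M′ :* ((a :- b) :* (a :- b)) :* (a :+ b)) refl M M′ α β ⟩
      M * M′ * ((α - β) * (α - β)) * (α + β)
        ≈⟨ *-congʳ h≈ ⟨
      h * (α + β) ∎)
      (integer-- (integer-* (integer-s 0) (integer-s 3)) (integer-* (integer-s 1) (integer-s 2)))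

    -- Unequal multiplicities make α and β rational, hence common denominators
    -- of all powers of α exist.
    integer-of-unequal : m ≢ m′ → IsInteger α
    integer-of-unequal m≢m′ = integer-of-bounded-denominators integer-c c≉0 integer-cα^
      where
      q = h * (M - M′)

      integer-qα : IsInteger (q * α)
      integer-qα = integer-resp
        (solve 5 (λ h M M′ a b → h :* (M :* (a :* con (+ 1)) :+ M′ :* (b :* con (+ 1))) :- M′ :* (h :* (a :+ b))
                                 := h :* (M :- M′) :* a) refl h M M′ α β)
        (integer-- (integer-* integer-h (integer-s 1)) (integer-* (integer-ℕ m′) integer-hσ))

      integer-qβ : IsInteger (q * β)
      integer-qβ = integer-resp
        (solve 5 (λ h M M′ a b → M :* (h :* (a :+ b)) :- h :* (M :* (a :* con (+ 1)) :+ M′ :* (b :* con (+ 1)))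
                                 := h :* (M :- M′) :* b) refl h M M′ α β)
        (integer-- (integer-* (integer-ℕ m) integer-hσ) (integer-* integer-h (integer-s 1)))

      integer-q : IsInteger q
      integer-q = integer-* integer-h (integer-- (integer-ℕ m) (integer-ℕ m′))

      -- In q s_{j+1} - (qβ) s_j the powers of β cancel and M (qα - qβ) αʲ remains. The factor q
      -- makes both coefficients integers, so `c₀` clears the denominators of all powers of α at
      -- once.
      c₀ = M * (q * α - q * β)

      integer-c : IsInteger c₀
      integer-c = integer-* (integer-ℕ m) (integer-- integer-qα integer-qβ)

      c≉0 : c₀ ≉ 0#
      c≉0 c≈0 = *-≉0 (ℕ→R≉0 m≢0) (*-≉0 (*-≉0 h≉0 M-M′≉0) α-β≉0)
        (trans (solve 4 (λ M q a b → M :* (q :* (a :- b)) := M :* (q :* a :- q :* b)) refl M q α β) c≈0)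
        where
        M-M′≉0 : M - M′ ≉ 0#
        M-M′≉0 M-M′≈0 = m≢m′ (ℕ→R-injective m m′ (x-y≈0⇒x≈y M-M′≈0))

      integer-cα^ : ∀ j → IsInteger (c₀ * α ^ j)
      integer-cα^ j = integer-resp
        (solve 7 (λ M M′ q a b x y →
            q :* (M :* (a :* x) :+ M′ :* (b :* y)) :- (q :* b) :* (M :* x :+ M′ :* y)
            := M :* (q :* a :- q :* b) :* x) refl M M′ q α β (α ^ j) (β ^ j))
        (integer-- (integer-* integer-q (integer-s (suc j))) (integer-* integer-qβ (integer-s j)))

    integer-product : IsInteger (α * β)
    integer-product = integer-of-bounded-denominators integer-h h≉0 (λ j → integer-resp (hankel j)
      (integer-- (integer-* (integer-s j) (integer-s (2 ℕ.+ j))) (integer-* (integer-s (suc j)) (integer-s (suc j)))))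
      where
      -- The Hankel matrix with entries s_j, s_{j+1}, s_{j+2} is V diag(m αʲ, m′ βʲ) Vᵀ for the
      -- Vandermonde matrix V of α and β, so passing from 0 to j multiplies its determinant by
      -- (αβ)ʲ.
      hankel : ∀ j → s j * s (2 ℕ.+ j) - s (suc j) * s (suc j) ≈ h * (α * β) ^ j
      hankel j = begin
        s j * s (2 ℕ.+ j) - s (suc j) * s (suc j)
          ≈⟨ solve 6 (λ M M′ a b x y →
               (M :* x :+ M′ :* y) :* (M :* (a :* (a :* x)) :+ M′ :* (b :* (b :* y)))
                 :- (M :* (a :* x) :+ M′ :* (b :* y)) :* (M :* (a :* x) :+ M′ :* (b :* y))
               := M :* M′ :* ((a :- b) :* (a :- b)) :* (x :* y)) refl M M′ α β (α ^ j) (β ^ j) ⟩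
        M * M′ * ((α - β) * (α - β)) * (α ^ j * β ^ j)
          ≈⟨ *-cong h≈ (^-distrib-* α β j) ⟨
        h * (α * β) ^ j ∎

    -- The common denominator of the powers of σ is s₀ = 2m. Products σⁱ s_j are integers by
    -- induction on i, from σ s_{j+1} = s_{j+2} + τ s_j and σ s₀ = 2 s₁; the last equation is where
    -- equal multiplicities enter.
    integer-sum-of-equal : m ≡ m′ → IsInteger (α + β)
    integer-sum-of-equal ≡.refl = integer-of-bounded-denominators (integer-s 0) s₀≉0
      (λ j → integer-resp (*-comm _ _) (integer-σ^-s j 0))
      where
      s₀≉0 : s 0 ≉ 0#
      s₀≉0 s₀≈0 = *-≉0 (ℕ→R≉0 m≢0) (charZero 1)
        (trans (solve 1 (λ M → M :* (con (+ 1) :+ (con (+ 1) :+ con (+ 0))) := M :* con (+ 1) :+ M :* con (+ 1)) refl M) s₀≈0)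

      integer-σ^-s : ∀ i j → IsInteger ((α + β) ^ i * s j)
      integer-σ^-s zero    j       = integer-resp (sym (*-identityˡ _)) (integer-s j)
      integer-σ^-s (suc i) zero    = integer-resp
        (solve 4 (λ M a b p → let s₁ = M :* (a :* con (+ 1)) :+ M :* (b :* con (+ 1)) in
                    p :* s₁ :+ p :* s₁ := (a :+ b) :* p :* (M :* con (+ 1) :+ M :* con (+ 1))) refl M α β ((α + β) ^ i))
        (integer-+ (integer-σ^-s i 1) (integer-σ^-s i 1))
      integer-σ^-s (suc i) (suc j) = integer-resp
        (solve 6 (λ M a b x y p →
            p :* (M :* (a :* (a :* x)) :+ M :* (b :* (b :* y))) :+ (a :* b) :* (p :* (M :* x :+ M :* y))
            := (a :+ b) :* p :* (M :* (a :* x) :+ M :* (b :* y))) refl M α β (α ^ j) (β ^ j) ((α + β) ^ i))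
        (integer-+ (integer-σ^-s i (2 ℕ.+ j)) (integer-* integer-product (integer-σ^-s i j)))

-- The sum of d² - d over the entries of A² + A + τ(I + J)

module SquareExcess {c ℓ : Level} (R : CommutativeRing c ℓ) where
  open CommutativeRing R hiding (zero)
  open Poly R using (ℕ→R)
  open IntegerCoefficients R
  open Matrices R
  open Spectrum R
  open SemiringSum semiring
  open Exterior R using (δ)
  open SetoidReasoning setoid

  shiftedSquare : ∀ {n} → Matrix n → Carrier → Matrix n
  shiftedSquare A τ i j = (A · A) i j + A i j + τ * δ i j + τ

  excess : ∀ {n} → Matrix n → Carrier → Carrier
  excess A τ = total (λ i j → shiftedSquare A τ i j * shiftedSquare A τ i j - shiftedSquare A τ i j)

  δ-idempotent : ∀ {n} (i j : Fin n) → δ i j * δ i j ≈ δ i j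
  δ-idempotent i j with i ≟ j
  ... | yes _ = *-identityˡ 1#
  ... | no _  = zeroˡ 0#

  total-δ : ∀ {n} → total {n} δ ≈ ℕ→R n
  total-δ {n} = begin
    total {n} δ                                 ≈⟨ total-cong {n} (λ i j → *-identityʳ (δ i j)) ⟨
    total {n} (λ i j → δ i j * 1#)              ≈⟨ sum-cong-≋ {n} (λ i → sum-δ i (λ _ → 1#)) ⟩
    sum {n} (λ _ → 1#)                          ≈⟨ sum-const n 1# ⟩
    ℕ→R n * 1#                                  ≈⟨ *-identityʳ _ ⟩
    ℕ→R n                                       ∎

  module _ {n k} (G : Graph n) (regular : Regular G k) (τ : Carrier) where
    private
      A = adjacency G
      N = ℕ→R n
      K = ℕ→R k
      p : ℕ → Carrier
      p l = trace (power· A l δ)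

      A-sym = adjacency-symmetric G

      -- The coefficients of d² - d, expanded in the entries of A², A, I and J after the squares of
      -- the 0-1 entries of A and I have been reduced.
      c₂ = 1# + 1#
      c₃ = τ + τ
      c₄ = τ + τ - 1#
      c₅ = τ * τ + τ * τ + τ * τ - τ
      c₆ = τ * τ - τ

      -- Partial sums of that expansion, each of the shape `X + c * Y` from which `total-linear`
      -- splits off the last term.
      e₀ e₁ e₂ e₃ e₄ e₅ e₆ e₇ : Matrix n
      e₀ i j = (A · A) i j * (A · A) i j
      e₁ i j = e₀ i j + c₂ * ((A · A) i j * A i j)
      e₂ i j = e₁ i j + c₃ * (δ i j * (A · A) i j)
      e₃ i j = e₂ i j + c₃ * (δ i j * A i j)
      e₄ i j = e₃ i j + c₄ * (A · A) i j
      e₅ i j = e₄ i j + c₃ * A i j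
      e₆ i j = e₅ i j + c₅ * δ i j
      e₇ i j = e₆ i j + c₆ * 1#

      pointwise : ∀ i j → shiftedSquare A τ i j * shiftedSquare A τ i j - shiftedSquare A τ i j ≈ e₇ i j
      pointwise i j = begin
        shiftedSquare A τ i j * shiftedSquare A τ i j - shiftedSquare A τ i j
          -- The remainder b² - b + t² (e² - e) is set apart because it vanishes only for entries b
          -- and e that are 0 or 1, which the ring solver cannot know.
          ≈⟨ solve 4 (λ a b e t → (a :+ b :+ t :* e :+ t) :* (a :+ b :+ t :* e :+ t) :- (a :+ b :+ t :* e :+ t) :=
               (((((((a :* a :+ (con (+ 1) :+ con (+ 1)) :* (a :* b)) :+ (t :+ t) :* (e :* a)) :+ (t :+ t) :* (e :* b))
                 :+ (t :+ t :- con (+ 1)) :* a) :+ (t :+ t) :* b) :+ (t :* t :+ t :* t :+ t :* t :- t) :* e)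
                 :+ (t :* t :- t) :* con (+ 1))
               :+ ((b :* b :- b) :+ t :* t :* (e :* e :- e)))
               refl ((A · A) i j) (A i j) (δ i j) τ ⟩
        e₇ i j + ((A i j * A i j - A i j) + τ * τ * (δ i j * δ i j - δ i j))
          ≈⟨ +-congˡ (+-cong (+-congʳ (adjacency-idempotent G regular i j)) (*-congˡ (+-congʳ (δ-idempotent i j)))) ⟩
        e₇ i j + ((A i j - A i j) + τ * τ * (δ i j - δ i j))
          ≈⟨ solve 4 (λ x b e t → x :+ ((b :- b) :+ t :* t :* (e :- e)) := x) refl (e₇ i j) (A i j) (δ i j) τ ⟩
        e₇ i j ∎

    excess≈ : excess A τ ≈
      p 4 + c₂ * p 3 + c₃ * p 2 + c₃ * p 1 + c₄ * (N * K * K) + c₃ * (N * K) + c₅ * N + c₆ * (N * (N * 1#))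
    excess≈ = begin
      excess A τ
        ≈⟨ total-cong pointwise ⟩
      total e₇
        ≈⟨ trans (total-linear c₆ e₆ (λ _ _ → 1#)) (+-congˡ (*-congˡ (total-const {n} 1#))) ⟩
      total e₆ + c₆ * (N * (N * 1#))
        ≈⟨ +-congʳ (trans (total-linear c₅ e₅ δ) (+-congˡ (*-congˡ (total-δ {n})))) ⟩
      total e₅ + c₅ * N + c₆ * (N * (N * 1#))
        ≈⟨ +-congʳ (+-congʳ (trans (total-linear c₃ e₄ A) (+-congˡ (*-congˡ (total-adjacency G regular))))) ⟩
      total e₄ + c₃ * (N * K) + c₅ * N + c₆ * (N * (N * 1#))
        ≈⟨ +-congʳ (+-congʳ (+-congʳ (trans (total-linear c₄ e₃ (A · A)) (+-congˡ (*-congˡ (total-adjacency² G regular)))))) ⟩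
      total e₃ + c₄ * (N * K * K) + c₃ * (N * K) + c₅ * N + c₆ * (N * (N * 1#))
        ≈⟨ +-congʳ (+-congʳ (+-congʳ (+-congʳ traces))) ⟩
      p 4 + c₂ * p 3 + c₃ * p 2 + c₃ * p 1 + c₄ * (N * K * K) + c₃ * (N * K) + c₅ * N + c₆ * (N * (N * 1#)) ∎
      where
      traces : total e₃ ≈ p 4 + c₂ * p 3 + c₃ * p 2 + c₃ * p 1
      traces = begin
        total e₃
          ≈⟨ trans (total-linear c₃ e₂ (λ i j → δ i j * A i j))
                   (+-congˡ (*-congˡ (trans (total-δ-* A) (sym (trace-power₁ A A-sym))))) ⟩
        total e₂ + c₃ * p 1
          ≈⟨ +-congʳ (trans (total-linear c₃ e₁ (λ i j → δ i j * (A · A) i j))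
                            (+-congˡ (*-congˡ (trans (total-δ-* (A · A)) (sym (trace-power₂ A A-sym)))))) ⟩
        total e₁ + c₃ * p 2 + c₃ * p 1
          ≈⟨ +-congʳ (+-congʳ (trans (total-linear c₂ e₀ (λ i j → (A · A) i j * A i j))
                                     (+-cong (sym (trace-power₄ A A-sym)) (*-congˡ (sym (trace-power₃ A A-sym)))))) ⟩
        p 4 + c₂ * p 3 + c₃ * p 2 + c₃ * p 1 ∎

-- Excluding the spectrum

2≤⇒≢0 : ∀ {n} → 2 ℕ.≤ n → n ≢ 0
2≤⇒≢0 () ≡.refl

2+2m<1+m[3+a] : ∀ m a → 2 ℕ.≤ m → 2 ℕ.+ (m ℕ.+ m) ℕ.< 1 ℕ.+ m ℕ.* (3 ℕ.+ a)
2+2m<1+m[3+a] m a 2≤m = begin-strict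
  2 ℕ.+ (m ℕ.+ m)           <⟨ ℕ.n<1+n _ ⟩
  1 ℕ.+ (2 ℕ.+ (m ℕ.+ m))   ≤⟨ ℕ.+-monoʳ-≤ 1 (ℕ.+-monoˡ-≤ (m ℕ.+ m) 2≤m) ⟩
  1 ℕ.+ (m ℕ.+ (m ℕ.+ m))   ≡⟨ solve 1 (λ m → con 1 :+ (m :+ (m :+ m)) := con 1 :+ m :* con 3) ≡.refl m ⟩
  1 ℕ.+ m ℕ.* 3             ≤⟨ ℕ.+-monoʳ-≤ 1 (ℕ.*-monoʳ-≤ m (ℕ.m≤m+n 3 a)) ⟩
  1 ℕ.+ m ℕ.* (3 ℕ.+ a)     ∎
  where
  open ℕ.≤-Reasoning
  open +-*-Solver

module FourEigenvalues {c ℓ : Level} (F : CharZeroField c ℓ) where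
  open CharZeroField F hiding (zero)
  open IntegerCoefficients commutativeRing
  open RingProperties ring
  open CommutativeSemiringExp commutativeSemiring using (_^_; ^-congˡ)
  open FieldProperties F
  open Matrices commutativeRing
  open Spectrum commutativeRing
  open SquareExcess commutativeRing
  open Exterior commutativeRing using (δ)
  open SetoidReasoning setoid

  -- A positive z would force m ≤ 1, and z ≤ -3 would force k ≥ 1 + 3m, which exceeds 2m + 2 once m
  -- ≥ 2. Both contradictions are equations between natural numbers pulled back from F.
  small-quotient : ∀ m k z → 2 ℕ.≤ m → k ℕ.≤ 2 ℕ.+ (m ℕ.+ m) → ℕ→R k + ℕ→R m * ℤ→R z ≈ 1# →
                   z ≡ + 0 ⊎ z ≡ -[1+ 0 ] ⊎ z ≡ -[1+ 1 ]
  small-quotient m k (+ zero)  2≤m k≤ eq = inj₁ ≡.refl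
  small-quotient m k (+ suc b) 2≤m k≤ eq = contradiction (ℕ.≤-trans 2≤m m≤1) (λ { (ℕ.s≤s ()) })
    where
    k+m[1+b]≡1 : k ℕ.+ m ℕ.* suc b ≡ 1
    k+m[1+b]≡1 = ℕ→R-injective _ 1 (begin
      ℕ→R (k ℕ.+ m ℕ.* suc b)        ≈⟨ trans (ℕ→R-+ k _) (+-congˡ (ℕ→R-* m (suc b))) ⟩
      ℕ→R k + ℕ→R m * ℕ→R (suc b)    ≈⟨ eq ⟩
      1#                             ≈⟨ +-identityʳ 1# ⟨
      ℕ→R 1                          ∎)

    m≤1 : m ℕ.≤ 1
    m≤1 = ℕ.≤-trans (ℕ.m≤m*n m (suc b)) (ℕ.≤-trans (ℕ.m≤n+m _ k) (ℕ.≤-reflexive k+m[1+b]≡1))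
  small-quotient m k -[1+ 0 ] 2≤m k≤ eq = inj₂ (inj₁ ≡.refl)
  small-quotient m k -[1+ 1 ] 2≤m k≤ eq = inj₂ (inj₂ ≡.refl)
  small-quotient m k -[1+ suc (suc a) ] 2≤m k≤ eq = contradiction k≤
    (ℕ.<⇒≱ (≡.subst (2 ℕ.+ (m ℕ.+ m) ℕ.<_) (≡.sym k≡) (2+2m<1+m[3+a] m a 2≤m)))
    where
    k≡ : k ≡ 1 ℕ.+ m ℕ.* (3 ℕ.+ a)
    k≡ = ℕ→R-injective _ _ (begin
      ℕ→R k
        ≈⟨ solve 3 (λ k m z → k := (k :+ m :* (:- z)) :+ m :* z) refl _ _ _ ⟩
      (ℕ→R k + ℕ→R m * - ℕ→R (3 ℕ.+ a)) + ℕ→R m * ℕ→R (3 ℕ.+ a)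
        ≈⟨ +-cong eq (sym (ℕ→R-* m (3 ℕ.+ a))) ⟩
      1# + ℕ→R (m ℕ.* (3 ℕ.+ a)) ∎)

  module Balanced
    {n m k : ℕ} (n≡2+2m : n ≡ 2 ℕ.+ (m ℕ.+ m)) (k≤n : k ℕ.≤ n) (2≤m : 2 ℕ.≤ m)
    (G : Graph n) (regular : Regular G k) {α β : Carrier}
    (α≁ℤ : NonInteger F α)
    (σ-integer : IsInteger (α + β))
    (power-sums : ∀ l → trace (power· (adjacency G) l δ) ≈
                        ℕ→R k ^ l + ((- 1#) ^ l + (ℕ→R m * α ^ l + ℕ→R m * β ^ l)))
    (τ-integer : IsInteger (α * β))
    where
    private
      A = adjacency G
      K = ℕ→R k
      M = ℕ→R m
      N = ℕ→R n
      σ = α + β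
      τ = α * β

      A-sym = adjacency-symmetric G

      2≉0 : 1# + 1# ≉ 0#
      2≉0 2≈0 = charZero 1 (trans (+-congˡ (+-identityʳ 1#)) 2≈0)

      M≉0 : M ≉ 0#
      M≉0 M≈0 = 2≤⇒≢0 2≤m (ℕ→R-injective m 0 M≈0)

      N≈ : N ≈ 1# + (1# + (M + M))
      N≈ = trans (reflexive (≡.cong ℕ→R n≡2+2m)) (+-congˡ (+-congˡ (ℕ→R-+ m m)))

    K+Mσ≈1 : K + M * σ ≈ 1#
    K+Mσ≈1 = x-y≈0⇒x≈y (begin
      K + M * σ - 1#
        ≈⟨ solve 4 (λ K M a b → K :+ M :* (a :+ b) :- con (+ 1) :=
             K :* con (+ 1) :+ ((:- con (+ 1)) :* con (+ 1) :+ (M :* (a :* con (+ 1)) :+ M :* (b :* con (+ 1)))))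
             refl K M α β ⟩
      K ^ 1 + ((- 1#) ^ 1 + (M * α ^ 1 + M * β ^ 1))
        ≈⟨ power-sums 1 ⟨
      trace (power· A 1 δ)
        ≈⟨ trans (trace-power₁ A A-sym) (trace-adjacency G regular) ⟩
      0# ∎)

    K≈ : K ≈ 1# - M * σ
    K≈ = trans (solve 2 (λ K x → K := (K :+ x) :- x) refl K (M * σ)) (+-congʳ K+Mσ≈1)

    -- This is tr A² = nk with k = 1 - mσ and n = 2 + 2m substituted: the terms without a factor m
    -- cancel, and m can be divided out.
    two-τ : (M + 1#) * (σ * σ) + (M + M) * σ - (1# + 1#) ≈ τ + τ
    two-τ = x-y≈0⇒x≈y (cancelˡ M≉0 (begin
      M * ((M + 1#) * (σ * σ) + (M + M) * σ - (1# + 1#) - (τ + τ))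
        ≈⟨ solve 3 (λ M a b → let σ = a :+ b; K = con (+ 1) :- M :* σ in
             M :* ((M :+ con (+ 1)) :* (σ :* σ) :+ (M :+ M) :* σ :- (con (+ 1) :+ con (+ 1)) :- (a :* b :+ a :* b))
             := K :* K :+ (con (+ 1) :+ (M :* (a :* (a :* con (+ 1))) :+ M :* (b :* (b :* con (+ 1)))))
                :- (con (+ 1) :+ (con (+ 1) :+ (M :+ M))) :* K) refl M α β ⟩
      (1# - M * σ) * (1# - M * σ) + (1# + (M * α ^ 2 + M * β ^ 2)) - (1# + (1# + (M + M))) * (1# - M * σ)
        ≈⟨ +-cong (+-congʳ (*-cong K≈ K≈)) (-‿cong (*-cong N≈ K≈)) ⟨
      K * K + (1# + (M * α ^ 2 + M * β ^ 2)) - N * K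
        ≈⟨ +-congʳ (solve 2 (λ K x → K :* K :+ (con (+ 1) :+ x) :=
             K :* (K :* con (+ 1)) :+ ((:- con (+ 1)) :* ((:- con (+ 1)) :* con (+ 1)) :+ x)) refl K _) ⟩
      K ^ 2 + ((- 1#) ^ 2 + (M * α ^ 2 + M * β ^ 2)) - N * K
        ≈⟨ x≈y⇒x-y≈0 (trans (sym (power-sums 2)) (trans (trace-power₂ A A-sym) (trace-adjacency² G regular))) ⟩
      0#
        ≈⟨ zeroʳ M ⟨
      M * 0# ∎))

    halve : ∀ {x y} → x + x ≈ y + y → x ≈ y
    halve {x} {y} 2x≈2y = cancelˡ 2≉0 (begin
      (1# + 1#) * x   ≈⟨ solve 1 (λ x → (con (+ 1) :+ con (+ 1)) :* x := x :+ x) refl x ⟩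
      x + x           ≈⟨ 2x≈2y ⟩
      y + y           ≈⟨ solve 1 (λ x → (con (+ 1) :+ con (+ 1)) :* x := x :+ x) refl y ⟨
      (1# + 1#) * y   ∎)

    two-τ-at : ∀ {x} → σ ≈ x → (M + 1#) * (x * x) + (M + M) * x - (1# + 1#) ≈ τ + τ
    two-τ-at σ≈x = trans (+-congʳ (+-cong (*-congˡ (sym (*-cong σ≈x σ≈x))) (*-congˡ (sym σ≈x)))) two-τ

    α-1≉0 : α - 1# ≉ 0#
    α-1≉0 eq = α≁ℤ (+ 1) (trans (x-y≈0⇒x≈y eq) (sym (+-identityʳ 1#)))

    α+1≉0 : α + 1# ≉ 0#
    α+1≉0 eq = α≁ℤ -[1+ 0 ] (trans (x-y≈0⇒x≈y (trans (+-congˡ (-‿involutive 1#)) eq)) (-‿cong (sym (+-identityʳ 1#))))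

    -- By `two-τ` this value gives τ = -1, so α is a root of x² - 1. Without decidable equality no
    -- root is singled out; instead the product of two nonzero factors would vanish.
    σ≉0 : σ ≉ 0#
    σ≉0 σ≈0 = *-≉0 α-1≉0 α+1≉0 (begin
      (α - 1#) * (α + 1#)
        ≈⟨ solve 2 (λ a b → (a :- con (+ 1)) :* (a :+ con (+ 1)) := a :* (a :+ b) :- a :* b :- con (+ 1)) refl α β ⟩
      α * σ - τ - 1#
        ≈⟨ +-congʳ (+-cong (*-congˡ σ≈0) (-‿cong (halve (trans (sym (two-τ-at σ≈0))
             (solve 1 (λ M → (M :+ con (+ 1)) :* (con (+ 0) :* con (+ 0)) :+ (M :+ M) :* con (+ 0) :- (con (+ 1) :+ con (+ 1))
                             := (:- con (+ 1)) :+ (:- con (+ 1))) refl M))))) ⟩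
      α * 0# - - 1# - 1#
        ≈⟨ solve 1 (λ a → a :* con (+ 0) :- :- con (+ 1) :- con (+ 1) := con (+ 0)) refl α ⟩
      0# ∎)

    -- Here `two-τ` gives τ = 1, whatever m is, so α is a root of (x + 1)².
    σ≉-2 : σ ≉ - (1# + 1#)
    σ≉-2 σ≈-2 = *-≉0 α+1≉0 α+1≉0 (begin
      (α + 1#) * (α + 1#)
        ≈⟨ solve 2 (λ a b → (a :+ con (+ 1)) :* (a :+ con (+ 1)) := a :* (a :+ b) :- a :* b :+ (a :+ a :+ con (+ 1))) refl α β ⟩
      α * σ - τ + (α + α + 1#)
        ≈⟨ +-congʳ (+-cong (*-congˡ σ≈-2) (-‿cong (halve (trans (sym (two-τ-at σ≈-2))
             (solve 1 (λ M → let -2′ = :- (con (+ 1) :+ con (+ 1)) in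
                        (M :+ con (+ 1)) :* (-2′ :* -2′) :+ (M :+ M) :* -2′ :- (con (+ 1) :+ con (+ 1))
                        := con (+ 1) :+ con (+ 1)) refl M))))) ⟩
      α * - (1# + 1#) - 1# + (α + α + 1#)
        ≈⟨ solve 1 (λ a → a :* (:- (con (+ 1) :+ con (+ 1))) :- con (+ 1) :+ (a :+ a :+ con (+ 1)) := con (+ 0)) refl α ⟩
      0# ∎)

    module _ (σ≈-1 : σ ≈ - 1#) where

      M≈τ : M ≈ - 1# - (τ + τ)
      M≈τ = begin
        M
          ≈⟨ solve 1 (λ M → M := :- con (+ 1) :- ((M :+ con (+ 1)) :* (:- con (+ 1) :* :- con (+ 1)) :+ (M :+ M) :* (:- con (+ 1)) :- (con (+ 1) :+ con (+ 1)))) refl M ⟩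
        - 1# - ((M + 1#) * (- 1# * - 1#) + (M + M) * - 1# - (1# + 1#))
          ≈⟨ +-congˡ (-‿cong (two-τ-at σ≈-1)) ⟩
        - 1# - (τ + τ) ∎

      K≈1+M : K ≈ 1# + M
      K≈1+M = trans K≈ (trans (+-congˡ (-‿cong (*-congˡ σ≈-1)))
        (solve 1 (λ M → con (+ 1) :- M :* (:- con (+ 1)) := con (+ 1) :+ M) refl M))

      K≈τ : K ≈ - (τ + τ)
      K≈τ = trans K≈1+M (trans (+-congˡ M≈τ) (solve 1 (λ t → con (+ 1) :+ (:- con (+ 1) :- (t :+ t)) := :- (t :+ t)) refl τ))

      N≈τ : N ≈ - (τ + τ) + - (τ + τ)
      N≈τ = trans N≈ (trans (+-congˡ (+-congˡ (+-cong M≈τ M≈τ)))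
        (solve 1 (λ t → con (+ 1) :+ (con (+ 1) :+ ((:- con (+ 1) :- (t :+ t)) :+ (:- con (+ 1) :- (t :+ t))))
                        := :- (t :+ t) :+ :- (t :+ t)) refl τ))

      -- The companion Lucas sequence V_l(-1, τ), that is, αˡ + βˡ as a polynomial in τ.
      lucas : ℕ → Carrier
      lucas zero          = 1# + 1#
      lucas (suc zero)    = - 1#
      lucas (suc (suc l)) = - lucas (suc l) - τ * lucas l

      lucas≈ : ∀ l → (α ^ l + β ^ l ≈ lucas l) × (α ^ suc l + β ^ suc l ≈ lucas (suc l))
      lucas≈ zero    = refl , trans (+-cong (*-identityʳ α) (*-identityʳ β)) σ≈-1
      lucas≈ (suc l) with lucas≈ l
      ... | v₀ , v₁ = v₁ , (begin
        α * (α * α ^ l) + β * (β * β ^ l)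
          ≈⟨ solve 4 (λ a b x y → a :* (a :* x) :+ b :* (b :* y) :=
               (a :+ b) :* (a :* x :+ b :* y) :- (a :* b) :* (x :+ y)) refl α β (α ^ l) (β ^ l) ⟩
        σ * (α ^ suc l + β ^ suc l) - τ * (α ^ l + β ^ l)
          ≈⟨ +-cong (trans (*-cong σ≈-1 v₁) (-1*x≈-x _)) (-‿cong (*-congˡ v₀)) ⟩
        - lucas (suc l) - τ * lucas l ∎)

      -- With m, k and n already expressed by τ, this leaves `excess A τ` as a polynomial in τ
      -- alone, which one call of the solver can evaluate.
      trace-τ : ∀ l → trace (power· A l δ) ≈ (- (τ + τ)) ^ l + ((- 1#) ^ l + (- 1# - (τ + τ)) * lucas l)
      trace-τ l = trans (power-sums l) (+-cong (^-congˡ l K≈τ) (+-congˡ (trans (sym (distribˡ M (α ^ l) (β ^ l)))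
        (*-cong M≈τ (proj₁ (lucas≈ l))))))

      -- The value agrees with the eigenvalues -τ and τ of D: the squares of its entries sum to tr
      -- D² = 2τ², and the entries themselves to n (-τ) = 4τ².
      excess-τ : excess A τ ≈ - (τ * τ + τ * τ)
      excess-τ = begin
        excess A τ
          ≈⟨ excess≈ G regular τ ⟩
        _ ≈⟨ +-cong (+-cong (+-cong (+-cong (+-cong (+-cong (+-cong (trace-τ 4) (*-congˡ (trace-τ 3))) (*-congˡ (trace-τ 2)))
               (*-congˡ (trans (trace-power₁ A A-sym) (trace-adjacency G regular))))
               (*-congˡ (*-cong (*-cong N≈τ K≈τ) K≈τ))) (*-congˡ (*-cong N≈τ K≈τ))) (*-congˡ N≈τ))
               (*-congˡ (*-cong N≈τ (*-congʳ N≈τ))) ⟩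
        _ ≈⟨ solve 1 (λ t →
               let one = con (+ 1); K = :- (t :+ t); M = :- one :- (t :+ t); N = K :+ K
                   v₂ = :- (:- one) :- t :* (one :+ one); v₃ = :- v₂ :- t :* (:- one); v₄ = :- v₃ :- t :* v₂
                   p₂ = K :* (K :* one) :+ (:- one :* (:- one :* one) :+ M :* v₂)
                   p₃ = K :* (K :* (K :* one)) :+ (:- one :* (:- one :* (:- one :* one)) :+ M :* v₃)
                   p₄ = K :* (K :* (K :* (K :* one))) :+ (:- one :* (:- one :* (:- one :* (:- one :* one))) :+ M :* v₄)
               in p₄ :+ (one :+ one) :* p₃ :+ (t :+ t) :* p₂ :+ (t :+ t) :* con (+ 0) :+ (t :+ t :- one) :* (N :* K :* K)
                  :+ (t :+ t) :* (N :* K) :+ (t :* t :+ t :* t :+ t :* t :- t) :* N :+ (t :* t :- t) :* (N :* (N :* one))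
                  := :- (t :* t :+ t :* t)) refl τ ⟩
        - (τ * τ + τ * τ) ∎

      integer-shiftedSquare : ∀ i j → IsInteger (shiftedSquare A τ i j)
      integer-shiftedSquare i j = integer-+ (integer-+ (integer-+
        (integer-sum (λ l → integer-* (integer-adjacency G i l) (integer-adjacency G l j)))
        (integer-adjacency G i j)) (integer-* τ-integer (integer-δ i j))) τ-integer

      natural-excess : IsNatural (excess A τ)
      natural-excess = natural-sum (λ i → natural-sum (λ j → natural-square-- (integer-shiftedSquare i j)))

      -- Since k = -2τ, a natural number e equal to -2τ² satisfies 2e + k² = 0. In ℕ this forces k =
      -- 0, against k = 1 + m.
      σ≈-1-impossible : IsNatural (excess A τ) → ⊥
      σ≈-1-impossible (e , excess≈e) = charZero m (trans (sym K≈1+M) (reflexive (≡.cong ℕ→R k≡0)))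
        where
        2e+k²≡0 : (e ℕ.+ e) ℕ.+ k ℕ.* k ≡ 0
        2e+k²≡0 = ℕ→R-injective _ 0 (begin
          ℕ→R ((e ℕ.+ e) ℕ.+ k ℕ.* k)
            ≈⟨ trans (ℕ→R-+ (e ℕ.+ e) (k ℕ.* k)) (+-cong (ℕ→R-+ e e) (ℕ→R-* k k)) ⟩
          (ℕ→R e + ℕ→R e) + K * K
            ≈⟨ +-cong (+-cong e≈ e≈) (*-cong K≈τ K≈τ) ⟩
          (- (τ * τ + τ * τ) + - (τ * τ + τ * τ)) + - (τ + τ) * - (τ + τ)
            ≈⟨ solve 1 (λ t → (:- (t :* t :+ t :* t) :+ :- (t :* t :+ t :* t)) :+ :- (t :+ t) :* :- (t :+ t) := con (+ 0)) refl τ ⟩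
          0# ∎)
          where
          e≈ : ℕ→R e ≈ - (τ * τ + τ * τ)
          e≈ = trans (sym excess≈e) excess-τ

        k≡0 : k ≡ 0
        k≡0 = reduce (ℕ.m*n≡0⇒m≡0∨n≡0 k (ℕ.m+n≡0⇒n≡0 (e ℕ.+ e) 2e+k²≡0))

    impossible : ⊥
    impossible = by-cases σ-integer
      where
      by-cases : IsInteger σ → ⊥
      by-cases (z , σ≈z) = cases (small-quotient m k z 2≤m (≡.subst (k ℕ.≤_) n≡2+2m k≤n)
                                   (trans (+-congˡ (*-congˡ (sym σ≈z))) K+Mσ≈1))
        where
        cases : z ≡ + 0 ⊎ z ≡ -[1+ 0 ] ⊎ z ≡ -[1+ 1 ] → ⊥
        cases (inj₁ ≡.refl)        = σ≉0 σ≈z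
        cases (inj₂ (inj₁ ≡.refl)) = σ≈-1-impossible σ≈-1 (natural-excess σ≈-1)
          where
          σ≈-1 : σ ≈ - 1#
          σ≈-1 = trans σ≈z (-‿cong (+-identityʳ 1#))
        cases (inj₂ (inj₂ ≡.refl)) = σ≉-2 (trans σ≈z (-‿cong (+-congˡ (+-identityʳ 1#))))

  integer-trace-power : ∀ {n} (G : Graph n) l → IsInteger (trace (power· (adjacency G) l δ))
  integer-trace-power G l = integer-sum (λ i → integer-power· (integer-adjacency G) l integer-δ i i)

  no-such-spectrum : ∀ {m m′ k} → 2 ℕ.≤ m → 2 ℕ.≤ m′ → (G : Graph (2 ℕ.+ (m ℕ.+ m′))) → Regular G k →
                     ∀ α β → α ≉ β → NonInteger F α → ¬ HasSpectrum F G k α m β m′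
  no-such-spectrum {m} {m′} {k} 2≤m 2≤m′ G regular α β α≉β α≁ℤ χ≈ = conclude (m ℕ.≟ m′)
    where
    open PowerSums F m m′ (2≤⇒≢0 2≤m) (2≤⇒≢0 2≤m′) α β
      using (s; integer-of-unequal; integer-product; integer-sum-of-equal)

    power-sums : ∀ l → trace (power· (adjacency G) l δ) ≈ ℕ→R k ^ l + ((- 1#) ^ l + s l)
    power-sums = trace-adjacency-power m {m′} G (ℕ→R k) α β χ≈

    integer-s : ∀ l → IsInteger (s l)
    integer-s l = integer-resp
      (trans (+-congʳ (+-congʳ (power-sums l))) (solve 3 (λ x y z → (x :+ (y :+ z)) :- x :- y := z) refl _ _ _))
      (integer-- (integer--
        (integer-trace-power G l)
        (integer-^ l (integer-ℕ k))) (integer-^ l (integer-neg integer-1)))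

    conclude : Dec (m ≡ m′) → ⊥
    conclude (no m≢m′)       = uncurry α≁ℤ (integer-of-unequal integer-s α≉β m≢m′)
    conclude (yes m≡m′@≡.refl) = Balanced.impossible ≡.refl
      (≡.subst (ℕ._≤ _) (regular zero) (degree≤ G zero)) 2≤m G regular α≁ℤ
      (integer-sum-of-equal integer-s α≉β m≡m′) power-sums (integer-product integer-s α≉β)

open import Data.Nat using (_+_; _∸_; _≤_)

theorem3p7 : ∀ {c ℓ : Level} (F : CharZeroField c ℓ) (n k m : ℕ) (G : Graph n)
    → Connected G → Regular G k
    → 2 ≤ m → m + 4 ≤ n
    → (α β : CharZeroField.Carrier F)
    → let open CharZeroField F in
    ¬ (ℕ→R k ≈ - 1#) → ¬ (ℕ→R k ≈ α) → ¬ (ℕ→R k ≈ β)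
    → ¬ (- 1# ≈ α) → ¬ (- 1# ≈ β) → ¬ (α ≈ β)
    → NonInteger F α → NonInteger F β
    → ¬ HasSpectrum F G k α m β (n ∸ 2 ∸ m)
theorem3p7 F n k m G _ regular 2≤m m+4≤n α β _ _ _ _ _ α≉β α≁ℤ _ =
  split (n ∸ 2 ∸ m) (ℕ.≤-trans (ℕ.≤-reflexive (≡.sym 4+m∸2∸m≡2)) (ℕ.∸-monoˡ-≤ m (ℕ.∸-monoˡ-≤ 2 4+m≤n))) n≡ G regular
  where
  4+m≤n : 4 + m ≤ n
  4+m≤n = ≡.subst (_≤ n) (ℕ.+-comm m 4) m+4≤n

  4+m∸2∸m≡2 : (4 + m) ∸ 2 ∸ m ≡ 2
  4+m∸2∸m≡2 = ℕ.m+n∸n≡m 2 m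

  n≡ : n ≡ 2 + (m + (n ∸ 2 ∸ m))
  n≡ = ≡.sym (≡.trans (≡.cong (λ l → 2 + l) (ℕ.m+[n∸m]≡n (ℕ.≤-trans (ℕ.m≤n+m m 2) (ℕ.∸-monoˡ-≤ 2 4+m≤n))))
                      (ℕ.m+[n∸m]≡n (ℕ.≤-trans (ℕ.m≤m+n 2 (2 + m)) 4+m≤n)))

  -- The second multiplicity becomes a variable, so that the equation for n can be matched with
  -- `refl`; with `n ∸ 2 ∸ m` in its place, n would occur on both sides.
  split : ∀ m′ → 2 ≤ m′ → ∀ {n} → n ≡ 2 + (m + m′) → (G : Graph n) → Regular G k → ¬ HasSpectrum F G k α m β m′
  split m′ 2≤m′ ≡.refl G regular = FourEigenvalues.no-such-spectrum F 2≤m 2≤m′ G regular α β α≉β α≁ℤ
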